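{- Let $n\ge 5$ and let $L_W$ be an $(n-2)$-club in $\mathrm{PG}(1,q^n)$. Then there exist $b\in\mathbb{F}_{q^n}\setminus\mathbb{F}_q$ and $\xi,\eta\in\mathbb{F}_{q^n}^*$ such that $L_W$ is $\mathrm{PGL}(2,q^n)$-equivalent to $L_p=L_{U_p}$, $U_p=\{(x,p(x)): x\in\mathbb{F}_{q^n}\}$, where $p(x)=\mathrm{Tr}_{q^n/q}(\xi x)+b\,\mathrm{Tr}_{q^n/q}(\eta x)$, and $\langle\xi,\eta\rangle_{\mathbb{F}_q}^\perp=\overline{S}\oplus c\langle 1,b,\ldots,b^{t-3}\rangle_{\mathbb{F}_q}$ (the second summand being $\{0\}$ when $t=2$), where $t=[\mathbb{F}_q(b):\mathbb{F}_q]$, $c\in\mathbb{F}_{q^n}^*$, and $\overline{S}$ is an $\mathbb{F}_{q^t}$-subspace of $\mathbb{F}_{q^n}$ of $\mathbb{F}_{q^t}$-dimension $n/t-1$.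
   Context: $q$ is a prime power. For an $\mathbb{F}_q$-subspace $U$ of $\mathbb{F}_{q^n}^2$, $L_U=\{\langle u\rangle_{\mathbb{F}_{q^n}}: u\in U\setminus\{0\}\}\subseteq\mathrm{PG}(1,q^n)$ has rank $\dim_{\mathbb{F}_q}U$; the weight of $P=\langle v\rangle_{\mathbb{F}_{q^n}}$ is $\dim_{\mathbb{F}_q}(U\cap\langle v\rangle_{\mathbb{F}_{q^n}})$. An $(n-2)$-club is an $\mathbb{F}_q$-linear set of rank $n$ with exactly one point of weight $n-2$ and all other points of weight $1$. $\perp$ is taken with respect to the bilinear form $(x,y)\mapsto\mathrm{Tr}_{q^n/q}(xy)$ on $\mathbb{F}_{q^n}$, where $\mathrm{Tr}_{q^n/q}(x)=\sum_{i=0}^{n-1}x^{q^i}$. Linear sets are $\mathrm{PGL}(2,q^n)$-equivalent if a projectivity maps one onto the other. -}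

module Defs where

open import Data.Nat as ℕ using (ℕ; zero; suc)
open import Data.Nat.Primality using (Prime)
open import Data.Fin using (Fin)
open import Data.Product using (Σ; ∃; _×_; _,_)
open import Relation.Binary.PropositionalEquality using (_≡_; _≢_)
open import Relation.Nullary using (¬_)
open import Algebra.Structures using (IsCommutativeRing)
open import Function.Bundles using (_↔_)

IsPrimePower : ℕ → Set
IsPrimePower q = Σ ℕ λ p → Σ ℕ λ e → Prime p × q ≡ p ℕ.^ suc e

record Field : Set₁ where
  infixl 6 _+_
  infixl 7 _*_
  field
    Carrier : Set
    _+_ _*_ : Carrier → Carrier → Carrier
    -_ : Carrier → Carrier
    0# 1# : Carrier
    isCommutativeRing : IsCommutativeRing _≡_ _+_ _*_ -_ 0# 1#
    _⁻¹ : Carrier → Carrier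
    ⁻¹-inverse : ∀ x → x ≢ 0# → x * (x ⁻¹) ≡ 1#
    0≢1 : 0# ≢ 1#

-- Everything below is relative to a field F (playing the role of F_{q^n}) and naturals q, n.
module Over (F : Field) (q n : ℕ) where
  open Field F public

  K : Set
  K = Carrier

  HasOrder : Set
  HasOrder = Carrier ↔ Fin (q ℕ.^ n)

  _^_ : K → ℕ → K
  x ^ zero = 1#
  x ^ suc k = x * (x ^ k)

  ∑ : (k : ℕ) → (Fin k → K) → K
  ∑ zero f = 0#
  ∑ (suc k) f = f Fin.zero + ∑ k (λ i → f (Fin.suc i))
    where import Data.Fin as Fin

  -- subfield F_{q^s} = {x : x^(q^s) = x}; F_q is the case s = 1
  𝔽 : ℕ → K → Set
  𝔽 s x = x ^ (q ℕ.^ s) ≡ x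

  Fq : K → Set
  Fq = 𝔽 1

  Tr : K → K
  Tr x = ∑ n (λ i → x ^ (q ℕ.^ Data.Fin.toℕ i))

  record VecSp : Set₁ where
    field
      V : Set
      _⊕_ : V → V → V
      𝟎 : V
      _·_ : K → V → V

  module Lin (VS : VecSp) (S : K → Set) where
    open VecSp VS

    ∑V : (k : ℕ) → (Fin k → V) → V
    ∑V zero f = 𝟎
    ∑V (suc k) f = f Data.Fin.zero ⊕ ∑V k (λ i → f (Data.Fin.suc i))

    comb : (k : ℕ) → (Fin k → K) → (Fin k → V) → V
    comb k l v = ∑V k (λ i → l i · v i)

    IsSubspace : (V → Set) → Set
    IsSubspace U = U 𝟎
                 × (∀ u w → U u → U w → U (u ⊕ w))
                 × (∀ l u → S l → U u → U (l · u))

    HasDim : (V → Set) → ℕ → Set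
    HasDim U k = Σ (Fin k → V) λ v →
        (∀ i → U (v i))
      × (∀ (l : Fin k → K) → (∀ i → S (l i)) → comb k l v ≡ 𝟎 → ∀ i → l i ≡ 0#)
      × (∀ u → U u → Σ (Fin k → K) λ l → (∀ i → S (l i)) × u ≡ comb k l v)

  K-VS : VecSp
  K-VS = record { V = K ; _⊕_ = _+_ ; 𝟎 = 0# ; _·_ = _*_ }

  K² : Set
  K² = K × K

  K²-VS : VecSp
  K²-VS = record { V = K² ; _⊕_ = λ { (a , b) (c , d) → (a + c , b + d) }
                 ; 𝟎 = (0# , 0#) ; _·_ = λ { l (a , b) → (l * a , l * b) } }

  _·²_ : K → K² → K²
  l ·² (a , b) = (l * a , l * b)

  0² : K²
  0² = (0# , 0#)

  Span : K² → K² → Set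
  Span v u = Σ K λ μ → u ≡ μ ·² v

  HasWeight : (K² → Set) → K² → ℕ → Set
  HasWeight U v w = Lin.HasDim K²-VS Fq (λ u → U u × Span v u) w

  -- the point ⟨v⟩ (v ≠ 0) belongs to L_U
  InL : (K² → Set) → K² → Set
  InL U v = Σ K² λ u → U u × u ≢ 0² × Span v u

  -- ⟨w⟩ = ⟨v⟩ as points (for nonzero w, v)
  SamePoint : K² → K² → Set
  SamePoint v w = Span v w

  IsClub : (K² → Set) → Set
  IsClub U = Lin.IsSubspace K²-VS Fq U
           × Lin.HasDim K²-VS Fq U n
           × Σ K² λ v → v ≢ 0² × HasWeight U v (n ℕ.∸ 2)
               × (∀ w → w ≢ 0² → InL U w → ¬ SamePoint v w → HasWeight U w 1)

  act : K → K → K → K → K² → K²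
  act a b c d (x , y) = (a * x + b * y , c * x + d * y)

  PGLEquiv : (K² → Set) → (K² → Set) → Set
  PGLEquiv U U' = Σ K λ a → Σ K λ b → Σ K λ c → Σ K λ d →
      (a * d + - (b * c)) ≢ 0#
    × (∀ v → v ≢ 0² → (InL U v → InL U' (act a b c d v)) × (InL U' (act a b c d v) → InL U v))

  Graph : (K → K) → K² → Set
  Graph f (x , y) = y ≡ f x

  Perp2 : K → K → K → Set
  Perp2 ξ η x = ∀ l m → Fq l → Fq m → Tr (x * (l * ξ + m * η)) ≡ 0#

  -- F_q(b) = F_q[b] = {∑_{i<n} λ_i b^i : λ_i ∈ F_q}
  Adjoin : K → K → Set
  Adjoin b x = Σ (Fin n → K) λ l → (∀ i → Fq (l i)) × x ≡ ∑ n (λ i → l i * (b ^ Data.Fin.toℕ i))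

  Degree : K → ℕ → Set
  Degree b t = Lin.HasDim K-VS Fq (Adjoin b) t

  -- c ⟨1, b, ..., b^{t-3}⟩_{F_q}  (= {0} when t = 2)
  CPow : K → K → ℕ → K → Set
  CPow c b t x = Σ (Fin (t ℕ.∸ 2) → K) λ l → (∀ i → Fq (l i))
      × x ≡ c * ∑ (t ℕ.∸ 2) (λ i → l i * (b ^ Data.Fin.toℕ i))

  DirectSum : (K → Set) → (K → Set) → (K → Set) → Set
  DirectSum A B C = (∀ x → A x → Σ K λ s → Σ K λ y → B s × C y × x ≡ s + y)
                  × (∀ s y → B s → C y → A (s + y))
                  × (∀ x → B x → C x → x ≡ 0#)

{-# OPTIONS --safe #-}
module Submission where

-- Since |W| = |K|, some point ⟨w⟩ ≠ ⟨v⟩ lies outside L_W, where ⟨v⟩ is the point of weight n-2. Moving v, w to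
-- (1,0), (0,1) turns W into the graph of an F_q-linear f whose kernel has q^(n-2) elements, so Im f = ⟨α, β⟩ and
-- f(x) = α (Tr(ξx) + b Tr(ηx)) with b = β/α. If ξ, η, bξ, bη were F_q-independent, nondegeneracy of the trace
-- form would give z with f(z) = α and f(bz) = bα, so that (z,α) and b(z,α) span a point of weight at least 2.
-- Hence they are dependent, and therefore ⟨ξ,η⟩ = ω⟨1,b⟩ for some ω ≠ 0.
-- Put E = F_q(b) = F_{q^t}, S = (ωE)^⊥, and choose c with Tr(cωb^i) = 0 for i < t-1 and Tr(cωb^(t-1)) = 1.
-- Then K = S ⊕ cE, and a vector s + c Σ e_i b^i is orthogonal to ω and ωb iff e_(t-1) = e_(t-2) = 0.

open import Defs
open import Algebra.Bundles using (CommutativeRing)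
import Algebra.Properties.CommutativeMonoid.Sum as MonoidSum
import Algebra.Properties.CommutativeSemiring.Binomial as Binomial
import Algebra.Properties.Ring as RingProperties
import Algebra.Properties.Semiring.Exp as SemiringExp
import Algebra.Properties.Semiring.Mult as SemiringMult
import Algebra.Properties.Semiring.Mult.TCOptimised as Mult
import Algebra.Solver.Ring as RingSolver
open import Algebra.Solver.Ring.AlmostCommutativeRing using (fromCommutativeRing; _-Raw-AlmostCommutative⟶_)
open import Data.Empty using (⊥; ⊥-elim)
open import Data.Fin as Fin using (Fin; zero; suc; toℕ; fromℕ; inject₁; punchOut; funToFin; finToFun; combine; remQuot)
open import Data.Fin.Permutation using (Permutation′; _⟨$⟩ʳ_)
import Data.Fin.Properties as Finₚ
open import Data.Fin.Relation.Unary.Top using (View; view; ‵fromℕ; ‵inject₁)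
open import Data.Integer as ℤ using (ℤ; -[1+_]; _⊖_)
import Data.Integer.Properties as ℤₚ
open import Data.Maybe using (Maybe; just; nothing)
open import Data.Nat as ℕ using (ℕ; zero; suc; _≤_; _<_; z≤n; s≤s; _∸_) renaming (_*_ to _*ℕ_)
open import Data.Nat.Combinatorics using (_C_; nCk+nC[k+1]≡[n+1]C[k+1]; nCn≡1; nC1≡n)
open import Data.Nat.Divisibility using (_∣_; divides; >⇒∤)
open import Data.Nat.Primality using (Prime; euclidsLemma; prime⇒nonZero; prime⇒nonTrivial)
import Data.Nat.Properties as ℕₚ
import Data.Nat.Solver as ℕSolver
open import Data.Product using (Σ; ∃; _×_; _,_; proj₁; proj₂)
open import Data.Sum using (_⊎_; inj₁; inj₂)
open import Data.Unit using (⊤; tt)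
open import Data.Vec.Functional using (_∷_)
open import Function using (_∘_; id)
open import Function.Bundles using (Inverse; mk↔ₛ′)
open import Function.Definitions using (Injective)
open import Relation.Binary.PropositionalEquality
open import Relation.Nullary using (¬_; Dec; yes; no; contradiction)
open import Relation.Nullary.Decidable using (map′; decidable-stable; ¬?; _×-dec_)

-- The field is known only through a bijection with a finite set of `q ^ n` elements, so the facts
-- about finite fields are obtained by counting. Injective maps between finite sets of equal size
-- being surjective yields Fermat's identity, the solution of square linear systems without
-- determinants, and equality of subspaces from an inclusion; dimensions are compared through powers
-- of q. That Tr is a polynomial of degree q^(n-1) yields both its nondegeneracy and |F_q| = q. The
-- passage from dependence to ω: a relation has the form (l₀ξ + l₁η) + b(l₂ξ + l₃η) = 0. With ω the
-- second bracket, ω and ωb both lie in ⟨ξ,η⟩, and they are independent because 1 and b are. The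
-- choice of c: pairing c Σ e_i b^i with ω reads off e_(t-1), and pairing it with ωb reads off
-- e_(t-2) plus a multiple of e_(t-1), which is why two top coefficients disappear. The orthogonal
-- space of ωE is stable under E, so S is an E-subspace; both its dimension and the divisibility of
-- n by t come from counting K = S ⊕ cE.

-- Counting in finite sets

injective⇒surjective : ∀ {m n} (f : Fin m → Fin n) → Injective _≡_ _≡_ f → n ≤ m → ∀ j → ∃ λ i → f i ≡ j
injective⇒surjective {m} {suc n} f inj n≤m j with Finₚ.any? (λ i → f i Finₚ.≟ j)
... | yes hit = hit
... | no ¬hit = contradiction (ℕₚ.≤-trans n≤m (Finₚ.injective⇒≤ {f = λ i → punchOut (j≢ i)} inj′)) ℕₚ.1+n≰n
  where
  j≢ : ∀ i → j ≢ f i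
  j≢ i eq = ¬hit (i , sym eq)
  inj′ : Injective _≡_ _≡_ (λ i → punchOut (j≢ i))
  inj′ eq = inj (Finₚ.punchOut-injective (j≢ _) (j≢ _) eq)

-- Indices are computed from a proof of membership, but injectivity of `at` makes them the same for
-- all proofs, so `P` may have several proofs at one point.
record Card {A : Set} (P : A → Set) (k : ℕ) : Set where
  field
    at       : Fin k → A
    at-∈     : ∀ i → P (at i)
    at-inj   : ∀ {i j} → at i ≡ at j → i ≡ j
    index    : ∀ x → P x → Fin k
    at-index : ∀ x p → at (index x p) ≡ x

  index-at : ∀ i {p} → index (at i) p ≡ i
  index-at i = at-inj (at-index _ _)

  index-inj : ∀ {x y p p′} → index x p ≡ index y p′ → x ≡ y
  index-inj eq = trans (sym (at-index _ _)) (trans (cong at eq) (at-index _ _))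

open Card

module _ {A B : Set} {P : A → Set} {Q : B → Set} {k l : ℕ} (cP : Card P k) (cQ : Card Q l)
         (f : A → B) (f-∈ : ∀ x → P x → Q (f x)) (f-inj : ∀ x y → P x → P y → f x ≡ f y → x ≡ y) where

  private
    g : Fin k → Fin l
    g i = index cQ (f (at cP i)) (f-∈ _ (at-∈ cP i))

    g-inj : Injective _≡_ _≡_ g
    g-inj eq = at-inj cP (f-inj _ _ (at-∈ cP _) (at-∈ cP _) (index-inj cQ eq))

  Card-≤ : k ≤ l
  Card-≤ = Finₚ.injective⇒≤ g-inj

  -- Applied below with `f` the identity: an inclusion of finite sets together with the reverse
  -- inequality of sizes is an equality.
  Card-surjective : l ≤ k → ∀ y → Q y → ∃ λ x → P x × f x ≡ y
  Card-surjective l≤k y Qy with injective⇒surjective g g-inj l≤k (index cQ y Qy)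
  ... | i , eq = at cP i , at-∈ cP i , index-inj cQ eq

Card-× : ∀ {A B : Set} {P : A → Set} {Q : B → Set} {k l} → Card P k → Card Q l →
         Card {A × B} (λ z → P (proj₁ z) × Q (proj₂ z)) (k ℕ.* l)
Card-× {k = k} {l} cP cQ = record
  { at       = λ i → at cP (proj₁ (remQuot {k} l i)) , at cQ (proj₂ (remQuot {k} l i))
  ; at-∈     = λ i → at-∈ cP _ , at-∈ cQ _
  ; at-inj   = λ {i} {j} eq → trans (sym (Finₚ.combine-remQuot {k} l i)) (trans
      (cong₂ combine (at-inj cP (cong proj₁ eq)) (at-inj cQ (cong proj₂ eq))) (Finₚ.combine-remQuot {k} l j))
  ; index    = λ { (x , y) (p , p′) → combine (index cP x p) (index cQ y p′) }
  ; at-index = λ { (x , y) (p , p′) → cong₂ _,_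
      (trans (cong (at cP ∘ proj₁) (Finₚ.remQuot-combine {k} (index cP x p) (index cQ y p′))) (at-index cP x p))
      (trans (cong (at cQ ∘ proj₂) (Finₚ.remQuot-combine {k} (index cP x p) (index cQ y p′))) (at-index cQ y p′)) }
  }

Card-Fin : ∀ {N} (P : Fin N → Set) → (∀ i → Dec (P i)) → ∃ (Card P)
Card-Fin {zero} P P? = 0 , record { at = λ () ; at-∈ = λ () ; at-inj = λ { {()} } ; index = λ () ; at-index = λ () }
Card-Fin {suc N} P P? with Card-Fin (P ∘ suc) (P? ∘ suc) | P? zero
... | k , c | no ¬p = k , record
  { at = suc ∘ at c ; at-∈ = at-∈ c ; at-inj = at-inj c ∘ Finₚ.suc-injective
  ; index = λ { zero p → ⊥-elim (¬p p) ; (suc i) p → index c i p }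
  ; at-index = λ { zero p → ⊥-elim (¬p p) ; (suc i) p → cong suc (at-index c i p) } }
... | k , c | yes p₀ = suc k , record
  { at = λ { zero → zero ; (suc i) → suc (at c i) }
  ; at-∈ = λ { zero → p₀ ; (suc i) → at-∈ c i }
  ; at-inj = λ { {zero} {zero} _ → refl ; {suc i} {suc j} eq → cong suc (at-inj c (Finₚ.suc-injective eq)) }
  ; index = λ { zero p → zero ; (suc i) p → suc (index c i p) }
  ; at-index = λ { zero p → refl ; (suc i) p → cong suc (at-index c i p) } }

-- Base-r digits number the coefficient vectors of length k, so that a search over all linear
-- combinations becomes a search over a finite type. Vectors are functions and are compared entry by
-- entry.
module Tuples {A : Set} {P : A → Set} {r : ℕ} (c : Card P r) (k : ℕ) where

  tuple : Fin (r ℕ.^ k) → Fin k → A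
  tuple j i = at c (finToFun {r} {k} j i)

  tuple-∈ : ∀ j i → P (tuple j i)
  tuple-∈ j i = at-∈ c _

  tuple-index : (l : Fin k → A) → (∀ i → P (l i)) → Fin (r ℕ.^ k)
  tuple-index l l∈ = funToFin (λ i → index c (l i) (l∈ i))

  tuple-tuple-index : ∀ l l∈ i → tuple (tuple-index l l∈) i ≡ l i
  tuple-tuple-index l l∈ i =
    trans (cong (at c) (Finₚ.finToFun-funToFin (λ i → index c (l i) (l∈ i)) i)) (at-index c _ _)

  private
    funToFin-cong : ∀ {m n} {f g : Fin m → Fin n} → (∀ i → f i ≡ g i) → funToFin f ≡ funToFin g
    funToFin-cong {zero}  eq = refl
    funToFin-cong {suc m} eq = cong₂ combine (eq zero) (funToFin-cong (eq ∘ suc))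

  tuple-inj : ∀ j j′ → (∀ i → tuple j i ≡ tuple j′ i) → j ≡ j′
  tuple-inj j j′ eq = trans (sym (Finₚ.funToFin-finToFin {k} {r} j))
    (trans (funToFin-cong {k} {r} (λ i → at-inj c (eq i))) (Finₚ.funToFin-finToFin {k} {r} j′))

-- Polynomial identities in a field

module FieldArithmetic (F : Field) where
  open Field F

  commutativeRing : CommutativeRing _ _
  commutativeRing = record { isCommutativeRing = isCommutativeRing }

  open CommutativeRing commutativeRing public
    using ( +-assoc; +-comm; +-identityˡ; +-identityʳ; -‿inverseˡ; -‿inverseʳ; *-assoc; *-comm
          ; *-identityˡ; *-identityʳ; distribˡ; distribʳ; zeroˡ; zeroʳ; ring; semiring; commutativeSemiring
          ; +-commutativeMonoid; *-commutativeMonoid )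
  open RingProperties ring public
    using (-‿distribˡ-*; -‿distribʳ-*; -‿+-comm; -‿involutive; -0#≈0#; +-cancelˡ; +-cancelʳ)
  open Mult semiring using (×-homo-+; ×1-homo-*; 1+×) renaming (_×_ to _×ₙ_)

  private
    ⟦_⟧ℤ : ℤ → Carrier
    ⟦ ℤ.+ m ⟧ℤ      = m ×ₙ 1#
    ⟦ -[1+ m ] ⟧ℤ = - (suc m ×ₙ 1#)

    cancel-+ : ∀ x y z → (x + y) + - (x + z) ≡ y + - z
    cancel-+ x y z = begin
      (x + y) + - (x + z)     ≡⟨ cong₂ _+_ (+-comm x y) (sym (-‿+-comm x z)) ⟩
      (y + x) + (- x + - z)   ≡⟨ +-assoc y x _ ⟩
      y + (x + (- x + - z))   ≡⟨ cong (y +_) (sym (+-assoc x _ _)) ⟩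
      y + ((x + - x) + - z)   ≡⟨ cong (λ u → y + (u + - z)) (-‿inverseʳ x) ⟩
      y + (0# + - z)          ≡⟨ cong (y +_) (+-identityˡ _) ⟩
      y + - z                 ∎
      where open ≡-Reasoning

    ⊖-homo : ∀ m n → ⟦ m ⊖ n ⟧ℤ ≡ m ×ₙ 1# + - (n ×ₙ 1#)
    ⊖-homo m       zero    = sym (trans (cong (m ×ₙ 1# +_) -0#≈0#) (+-identityʳ _))
    ⊖-homo zero    (suc n) = sym (+-identityˡ _)
    ⊖-homo (suc m) (suc n) = begin
      ⟦ suc m ⊖ suc n ⟧ℤ                        ≡⟨ cong ⟦_⟧ℤ (ℤₚ.[1+m]⊖[1+n]≡m⊖n m n) ⟩
      ⟦ m ⊖ n ⟧ℤ                                ≡⟨ ⊖-homo m n ⟩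
      m ×ₙ 1# + - (n ×ₙ 1#)                     ≡⟨ sym (cancel-+ 1# _ _) ⟩
      (1# + m ×ₙ 1#) + - (1# + n ×ₙ 1#)         ≡⟨ cong₂ (λ u v → u + - v) (sym (1+× m 1#)) (sym (1+× n 1#)) ⟩
      suc m ×ₙ 1# + - (suc n ×ₙ 1#)             ∎
      where open ≡-Reasoning

    +-homo : ∀ i j → ⟦ i ℤ.+ j ⟧ℤ ≡ ⟦ i ⟧ℤ + ⟦ j ⟧ℤ
    +-homo (ℤ.+ m)      (ℤ.+ n)      = ×-homo-+ 1# m n
    +-homo (ℤ.+ m)      -[1+ n ]   = ⊖-homo m (suc n)
    +-homo -[1+ m ]   (ℤ.+ n)      = trans (⊖-homo n (suc m)) (+-comm _ _)
    +-homo -[1+ m ]   -[1+ n ]   = trans (cong (λ k → - (k ×ₙ 1#)) (cong suc (sym (ℕₚ.+-suc m n))))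
                                     (trans (cong -_ (×-homo-+ 1# (suc m) (suc n))) (sym (-‿+-comm _ _)))

    -‿homo : ∀ i → ⟦ ℤ.- i ⟧ℤ ≡ - ⟦ i ⟧ℤ
    -‿homo (ℤ.+ zero)  = sym -0#≈0#
    -‿homo (ℤ.+ suc n) = refl
    -‿homo -[1+ n ]  = sym (-‿involutive _)

    *-homo : ∀ i j → ⟦ i ℤ.* j ⟧ℤ ≡ ⟦ i ⟧ℤ * ⟦ j ⟧ℤ
    *-homo (ℤ.+ m) (ℤ.+ n) = trans (cong ⟦_⟧ℤ (sym (ℤₚ.pos-* m n))) (×1-homo-* m n)
    *-homo (ℤ.+ m) -[1+ n ] = begin
      ⟦ ℤ.+ m ℤ.* -[1+ n ] ⟧ℤ           ≡⟨ cong ⟦_⟧ℤ (sym (ℤₚ.neg-distribʳ-* (ℤ.+ m) (ℤ.+ suc n))) ⟩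
      ⟦ ℤ.- (ℤ.+ m ℤ.* ℤ.+ suc n) ⟧ℤ      ≡⟨ -‿homo (ℤ.+ m ℤ.* ℤ.+ suc n) ⟩
      - ⟦ ℤ.+ m ℤ.* ℤ.+ suc n ⟧ℤ          ≡⟨ cong -_ (*-homo (ℤ.+ m) (ℤ.+ suc n)) ⟩
      - (m ×ₙ 1# * suc n ×ₙ 1#)       ≡⟨ -‿distribʳ-* _ _ ⟩
      m ×ₙ 1# * - (suc n ×ₙ 1#)       ∎
      where open ≡-Reasoning
    *-homo -[1+ m ] (ℤ.+ n) = begin
      ⟦ -[1+ m ] ℤ.* ℤ.+ n ⟧ℤ           ≡⟨ cong ⟦_⟧ℤ (sym (ℤₚ.neg-distribˡ-* (ℤ.+ suc m) (ℤ.+ n))) ⟩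
      ⟦ ℤ.- (ℤ.+ suc m ℤ.* ℤ.+ n) ⟧ℤ      ≡⟨ -‿homo (ℤ.+ suc m ℤ.* ℤ.+ n) ⟩
      - ⟦ ℤ.+ suc m ℤ.* ℤ.+ n ⟧ℤ          ≡⟨ cong -_ (*-homo (ℤ.+ suc m) (ℤ.+ n)) ⟩
      - (suc m ×ₙ 1# * n ×ₙ 1#)       ≡⟨ -‿distribˡ-* _ _ ⟩
      - (suc m ×ₙ 1#) * n ×ₙ 1#       ∎
      where open ≡-Reasoning
    *-homo -[1+ m ] -[1+ n ] = begin
      (suc m ℕ.* suc n) ×ₙ 1#                   ≡⟨ ×1-homo-* (suc m) (suc n) ⟩
      suc m ×ₙ 1# * suc n ×ₙ 1#                 ≡⟨ sym (-‿involutive _) ⟩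
      - - (suc m ×ₙ 1# * suc n ×ₙ 1#)           ≡⟨ cong -_ (-‿distribʳ-* _ _) ⟩
      - (suc m ×ₙ 1# * - (suc n ×ₙ 1#))         ≡⟨ -‿distribˡ-* _ _ ⟩
      - (suc m ×ₙ 1#) * - (suc n ×ₙ 1#)         ∎
      where open ≡-Reasoning

    -- Coefficients are integers because their equality can be decided, unlike that of elements of
    -- an arbitrary field. Distinct integers may agree in positive characteristic, so `coeff≟` only
    -- ever confirms equality.
    morphism : ℤ.+-*-rawRing -Raw-AlmostCommutative⟶ fromCommutativeRing commutativeRing
    morphism = record
      { ⟦_⟧ = ⟦_⟧ℤ ; +-homo = +-homo ; *-homo = *-homo ; -‿homo = -‿homo ; 0-homo = refl ; 1-homo = refl }

    coeff≟ : ∀ i j → Maybe (⟦ i ⟧ℤ ≡ ⟦ j ⟧ℤ)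
    coeff≟ i j with i ℤₚ.≟ j
    ... | yes i≡j = just (cong ⟦_⟧ℤ i≡j)
    ... | no  _   = nothing

  open RingSolver ℤ.+-*-rawRing (fromCommutativeRing commutativeRing) morphism coeff≟ public
    using (solve; _:=_; _:+_; _:*_; :-_; con)

-- Binomial coefficients modulo a prime; comparison of powers

C-absorption : ∀ n k → suc k *ℕ (suc n C suc k) ≡ suc n *ℕ (n C k)
C-absorption n zero = trans (ℕₚ.+-identityʳ _) (trans (nC1≡n (suc n)) (sym (ℕₚ.*-identityʳ (suc n))))
C-absorption zero (suc k) = ℕₚ.*-zeroʳ (suc (suc k))
C-absorption (suc n) (suc k) = begin
  suc (suc k) *ℕ (suc (suc n) C suc (suc k))
    ≡⟨ cong (suc (suc k) *ℕ_) (sym (nCk+nC[k+1]≡[n+1]C[k+1] (suc n) (suc k))) ⟩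
  suc (suc k) *ℕ ((suc n C suc k) ℕ.+ (suc n C suc (suc k)))
    ≡⟨ solve 3 (λ a x y → (con 1 :+ a) :* (x :+ y) := (a :* x :+ (con 1 :+ a) :* y) :+ x) refl (suc k) (suc n C suc k) (suc n C suc (suc k)) ⟩
  (suc k *ℕ (suc n C suc k) ℕ.+ suc (suc k) *ℕ (suc n C suc (suc k))) ℕ.+ (suc n C suc k)
    ≡⟨ cong (ℕ._+ (suc n C suc k)) (cong₂ ℕ._+_ (C-absorption n k) (C-absorption n (suc k))) ⟩
  (suc n *ℕ (n C k) ℕ.+ suc n *ℕ (n C suc k)) ℕ.+ (suc n C suc k)
    ≡⟨ cong (ℕ._+ (suc n C suc k)) (sym (ℕₚ.*-distribˡ-+ (suc n) (n C k) (n C suc k))) ⟩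
  suc n *ℕ ((n C k) ℕ.+ (n C suc k)) ℕ.+ (suc n C suc k)
    ≡⟨ cong (λ u → suc n *ℕ u ℕ.+ (suc n C suc k)) (nCk+nC[k+1]≡[n+1]C[k+1] n k) ⟩
  suc n *ℕ (suc n C suc k) ℕ.+ (suc n C suc k)
    ≡⟨ ℕₚ.+-comm (suc n *ℕ (suc n C suc k)) _ ⟩
  suc (suc n) *ℕ (suc n C suc k) ∎
  where
  open ≡-Reasoning
  open ℕSolver.+-*-Solver

-- By `C-absorption` the prime divides `suc k` times the binomial coefficient, and it cannot divide
-- the smaller positive number `suc k`.
prime∣C : ∀ {p} → Prime (suc p) → ∀ {k} → k < p → suc p ∣ (suc p C suc k)
prime∣C {p} pr {k} k<p with euclidsLemma (suc k) (suc p C suc k) pr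
  (divides (p C k) (trans (C-absorption p k) (ℕₚ.*-comm (suc p) (p C k))))
... | inj₁ p∣k = contradiction p∣k (>⇒∤ (s≤s k<p))
... | inj₂ p∣C = p∣C

^-cancelʳ-≤ : ∀ {q} → 2 ≤ q → ∀ a b → q ℕ.^ a ≤ q ℕ.^ b → a ≤ b
^-cancelʳ-≤ {q} 2≤q a b le with a ℕ.≤? b
... | yes a≤b = a≤b
... | no a≰b = contradiction le (ℕₚ.<⇒≱ (ℕₚ.^-monoʳ-< q 2≤q (ℕₚ.≰⇒> a≰b)))

^-injectiveʳ : ∀ {q} → 2 ≤ q → ∀ a b → q ℕ.^ a ≡ q ℕ.^ b → a ≡ b
^-injectiveʳ 2≤q a b eq = ℕₚ.≤-antisym (^-cancelʳ-≤ 2≤q a b (ℕₚ.≤-reflexive eq)) (^-cancelʳ-≤ 2≤q b a (ℕₚ.≤-reflexive (sym eq)))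

-- Provides a termination bound: k independent elements over a field of r elements give r^k ≤ |K|,
-- hence k < |K|.
n<q^n : ∀ {q} → 2 ≤ q → ∀ k → k < q ℕ.^ k
n<q^n 2≤q zero = s≤s z≤n
n<q^n {q} 2≤q (suc k) = begin-strict
  suc k             ≤⟨ n<q^n 2≤q k ⟩
  q ℕ.^ k           <⟨ ℕₚ.^-monoʳ-< q 2≤q (ℕₚ.n<1+n k) ⟩
  q ℕ.^ suc k       ∎
  where open ℕₚ.≤-Reasoning

-- Powers, sums and polynomial functions

module Basics (F : Field) (q n : ℕ) where
  open Over F q n public
  open FieldArithmetic F public

  x-y≡0⇒x≡y : ∀ {x y} → x + - y ≡ 0# → x ≡ y
  x-y≡0⇒x≡y {x} {y} eq = begin
    x               ≡⟨ solve 2 (λ x y → x := (x :+ :- y) :+ y) refl x y ⟩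
    (x + - y) + y   ≡⟨ cong (_+ y) eq ⟩
    0# + y          ≡⟨ +-identityˡ y ⟩
    y               ∎
    where open ≡-Reasoning

  x≡y⇒x-y≡0 : ∀ {x y} → x ≡ y → x + - y ≡ 0#
  x≡y⇒x-y≡0 {x} refl = -‿inverseʳ x

  *-cancelˡ-0 : ∀ {x y} → x ≢ 0# → x * y ≡ 0# → y ≡ 0#
  *-cancelˡ-0 {x} {y} x≢0 eq = begin
    y                  ≡⟨ sym (*-identityˡ y) ⟩
    1# * y             ≡⟨ cong (_* y) (sym (⁻¹-inverse x x≢0)) ⟩
    x * (x ⁻¹) * y     ≡⟨ solve 3 (λ x z y → x :* z :* y := z :* (x :* y)) refl x (x ⁻¹) y ⟩
    (x ⁻¹) * (x * y)   ≡⟨ cong ((x ⁻¹) *_) eq ⟩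
    (x ⁻¹) * 0#        ≡⟨ zeroʳ _ ⟩
    0#                 ∎
    where open ≡-Reasoning

  *-≢0 : ∀ {x y} → x ≢ 0# → y ≢ 0# → x * y ≢ 0#
  *-≢0 x≢0 y≢0 eq = y≢0 (*-cancelˡ-0 x≢0 eq)

  *-cancelˡ : ∀ {x y z} → x ≢ 0# → x * y ≡ x * z → y ≡ z
  *-cancelˡ {x} {y} {z} x≢0 eq = x-y≡0⇒x≡y (*-cancelˡ-0 x≢0
    (trans (solve 3 (λ x y z → x :* (y :+ :- z) := x :* y :+ :- (x :* z)) refl x y z) (x≡y⇒x-y≡0 eq)))

  ⁻¹-≢0 : ∀ {x} → x ≢ 0# → x ⁻¹ ≢ 0#
  ⁻¹-≢0 {x} x≢0 eq = 0≢1 (trans (sym (zeroʳ x)) (trans (cong (x *_) (sym eq)) (⁻¹-inverse x x≢0)))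

  ^-+ : ∀ x a b → x ^ (a ℕ.+ b) ≡ (x ^ a) * (x ^ b)
  ^-+ x zero b = sym (*-identityˡ _)
  ^-+ x (suc a) b = trans (cong (x *_) (^-+ x a b)) (sym (*-assoc _ _ _))

  ^-distrib-* : ∀ x y a → (x * y) ^ a ≡ (x ^ a) * (y ^ a)
  ^-distrib-* x y zero = sym (*-identityˡ _)
  ^-distrib-* x y (suc a) = trans (cong ((x * y) *_) (^-distrib-* x y a))
    (solve 4 (λ x y u v → x :* y :* (u :* v) := x :* u :* (y :* v)) refl x y (x ^ a) (y ^ a))

  1^ : ∀ a → 1# ^ a ≡ 1#
  1^ zero = refl
  1^ (suc a) = trans (*-identityˡ _) (1^ a)

  0^ : ∀ {a} → 1 ≤ a → 0# ^ a ≡ 0#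
  0^ {suc a} _ = zeroˡ _

  ^-* : ∀ x a b → x ^ (a *ℕ b) ≡ (x ^ a) ^ b
  ^-* x zero b = sym (1^ b)
  ^-* x (suc a) b = begin
    x ^ (b ℕ.+ a *ℕ b)           ≡⟨ ^-+ x b (a *ℕ b) ⟩
    (x ^ b) * (x ^ (a *ℕ b))     ≡⟨ cong ((x ^ b) *_) (^-* x a b) ⟩
    (x ^ b) * ((x ^ a) ^ b)      ≡⟨ sym (^-distrib-* x (x ^ a) b) ⟩
    (x * (x ^ a)) ^ b            ∎
    where open ≡-Reasoning

  ∑-cong : ∀ k {f g : Fin k → K} → (∀ i → f i ≡ g i) → ∑ k f ≡ ∑ k g
  ∑-cong zero eq = refl
  ∑-cong (suc k) eq = cong₂ _+_ (eq zero) (∑-cong k (eq ∘ suc))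

  ∑-0 : ∀ k {f : Fin k → K} → (∀ i → f i ≡ 0#) → ∑ k f ≡ 0#
  ∑-0 zero eq = refl
  ∑-0 (suc k) eq = trans (cong₂ _+_ (eq zero) (∑-0 k (eq ∘ suc))) (+-identityˡ 0#)

  ∑-+ : ∀ k (f g : Fin k → K) → ∑ k (λ i → f i + g i) ≡ ∑ k f + ∑ k g
  ∑-+ zero f g = sym (+-identityˡ 0#)
  ∑-+ (suc k) f g = trans (cong ((f zero + g zero) +_) (∑-+ k (f ∘ suc) (g ∘ suc)))
    (solve 4 (λ a b x y → (a :+ b) :+ (x :+ y) := (a :+ x) :+ (b :+ y)) refl (f zero) (g zero) _ _)

  ∑-*ˡ : ∀ k c (f : Fin k → K) → c * ∑ k f ≡ ∑ k (λ i → c * f i)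
  ∑-*ˡ zero c f = zeroʳ c
  ∑-*ˡ (suc k) c f = trans (distribˡ c _ _) (cong (c * f zero +_) (∑-*ˡ k c (f ∘ suc)))

  ∑-snoc : ∀ k (f : Fin (suc k) → K) → ∑ (suc k) f ≡ ∑ k (f ∘ inject₁) + f (fromℕ k)
  ∑-snoc zero f = +-comm _ _
  ∑-snoc (suc k) f = trans (cong (f zero +_) (∑-snoc k (f ∘ suc))) (sym (+-assoc _ _ _))

  -- Deg d a f: f is a polynomial function a x^d + (lower terms), expressed through its difference quotients;
  -- the leading coefficient a may be 0.
  Deg : ℕ → K → (K → K) → Set
  Deg zero    a f = ∀ x → f x ≡ a
  Deg (suc d) a f = ∀ c → Σ (K → K) λ g → Deg d a g × (∀ x → f x ≡ f c + (x + - c) * g x)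

  Deg-cong : ∀ d {a f g} → (∀ x → f x ≡ g x) → Deg d a f → Deg d a g
  Deg-cong zero eq D x = trans (sym (eq x)) (D x)
  Deg-cong (suc d) eq D c with D c
  ... | h , Dh , e = h , Dh , λ x → trans (sym (eq x)) (trans (e x) (cong (_+ _) (eq c)))

  Deg-+ : ∀ d {a b f g} → Deg d a f → Deg d b g → Deg d (a + b) (λ x → f x + g x)
  Deg-+ zero Df Dg x = cong₂ _+_ (Df x) (Dg x)
  Deg-+ (suc d) {f = f} {g} Df Dg c with Df c | Dg c
  ... | h , Dh , e | h′ , Dh′ , e′ = (λ x → h x + h′ x) , Deg-+ d Dh Dh′ , λ x → trans (cong₂ _+_ (e x) (e′ x))
    (solve 5 (λ a b z u v → (a :+ z :* u) :+ (b :+ z :* v) := (a :+ b) :+ z :* (u :+ v)) refl (f c) (g c) (x + - c) (h x) (h′ x))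

  Deg-*ˡ : ∀ d {a f} k → Deg d a f → Deg d (k * a) (λ x → k * f x)
  Deg-*ˡ zero k D x = cong (k *_) (D x)
  Deg-*ˡ (suc d) {f = f} k D c with D c
  ... | h , Dh , e = (λ x → k * h x) , Deg-*ˡ d k Dh , λ x → trans (cong (k *_) (e x))
    (solve 4 (λ k a z u → k :* (a :+ z :* u) := k :* a :+ z :* (k :* u)) refl k (f c) (x + - c) (h x))

  Deg-const : ∀ d k → Deg (suc d) 0# (λ _ → k)
  Deg-const zero k c = (λ _ → 0#) , (λ _ → refl) , λ x → solve 2 (λ k z → k := k :+ z :* con ℤ.0ℤ) refl k (x + - c)
  Deg-const (suc d) k c = (λ _ → 0#) , Deg-const d 0# , λ x → solve 2 (λ k z → k := k :+ z :* con ℤ.0ℤ) refl k (x + - c)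

  Deg-raise : ∀ d {a f} → Deg d a f → Deg (suc d) 0# f
  Deg-raise zero {a} D = Deg-cong 1 (λ x → sym (D x)) (Deg-const 0 a)
  Deg-raise (suc d) D c with D c
  ... | h , Dh , e = h , Deg-raise d Dh , e

  Deg-<  : ∀ {d d′ a f} → d < d′ → Deg d a f → Deg d′ 0# f
  Deg-< {d} {d′} {f = f} d<d′ D = go (ℕₚ.≤⇒≤′ d<d′)
    where
    go : ∀ {d′} → suc d ℕ.≤′ d′ → Deg d′ 0# f
    go (ℕ.≤′-reflexive refl) = Deg-raise d D
    go (ℕ.≤′-step le) = Deg-raise _ (go le)

  -- The difference quotient of x f(x) at c is f(x) + c h(x), with h that of f. Since h has lower
  -- degree than f, the leading coefficient stays that of f.
  Deg-x* : ∀ d {a f} → Deg d a f → Deg (suc d) a (λ x → x * f x)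
  Deg-x* zero {a} {f} D c = f , D , λ x → trans (cong (x *_) (D x))
    (trans (solve 3 (λ x c a → x :* a := c :* a :+ (x :+ :- c) :* a) refl x c a)
           (cong₂ (λ u v → c * u + (x + - c) * v) (sym (D c)) (sym (D x))))
  Deg-x* (suc d) {a} {f} D c with D c
  ... | h , Dh , e = (λ x → f x + c * h x)
    , subst (λ a → Deg (suc d) a _) (trans (cong (a +_) (zeroʳ c)) (+-identityʳ a)) (Deg-+ (suc d) D (Deg-*ˡ (suc d) c (Deg-raise d Dh)))
    , λ x → begin
      x * f x                                       ≡⟨ solve 3 (λ x c y → x :* y := c :* y :+ (x :+ :- c) :* y) refl x c (f x) ⟩
      c * f x + (x + - c) * f x                     ≡⟨ cong (λ u → c * u + (x + - c) * f x) (e x) ⟩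
      c * (f c + (x + - c) * h x) + (x + - c) * f x ≡⟨ solve 5 (λ c k z u y → c :* (k :+ z :* u) :+ z :* y := c :* k :+ z :* (y :+ c :* u)) refl c (f c) (x + - c) (h x) (f x) ⟩
      c * f c + (x + - c) * (f x + c * h x)         ∎
    where open ≡-Reasoning

  Deg-^ : ∀ d → Deg d 1# (_^ d)
  Deg-^ zero x = refl
  Deg-^ (suc d) = Deg-x* d (Deg-^ d)

  -- Split off the first root: the difference quotient there has degree one less and the same
  -- leading coefficient, and it vanishes at every other root because a field has no zero divisors.
  roots≤Deg : ∀ d {a f} → a ≢ 0# → Deg d a f → ∀ k (e : Fin k → K) → (∀ {i j} → e i ≡ e j → i ≡ j) →
              (∀ i → f (e i) ≡ 0#) → k ≤ d
  roots≤Deg d       a≢0 D zero    e inj root = z≤n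
  roots≤Deg zero    a≢0 D (suc k) e inj root = contradiction (trans (sym (D _)) (root zero)) a≢0
  roots≤Deg (suc d) a≢0 D (suc k) e inj root with D (e zero)
  ... | h , Dh , eq = s≤s (roots≤Deg d a≢0 Dh k (e ∘ suc) (λ {i} {j} eq → Finₚ.suc-injective (inj eq)) root′)
    where
    root′ : ∀ i → h (e (suc i)) ≡ 0#
    root′ i = *-cancelˡ-0 {e (suc i) + - e zero} (λ z → Finₚ.0≢1+n (sym (inj (x-y≡0⇒x≡y z))))
      (trans (sym (trans (eq (e (suc i))) (trans (cong (_+ _) (root zero)) (+-identityˡ _)))) (root (suc i)))

-- Characteristic, Frobenius maps and Fermat's identity

module FiniteField (F : Field) (q n : ℕ) (pp : IsPrimePower q) (1≤n : 1 ≤ n) (ord : Over.HasOrder F q n) where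
  open Basics F q n public

  Card-K : Card {K} (λ _ → ⊤) (q ℕ.^ n)
  Card-K = record
    { at = Inverse.from ord ; at-∈ = λ _ → tt
    ; at-inj = λ {i} {j} eq → trans (sym (Inverse.strictlyInverseˡ ord i)) (trans (cong (Inverse.to ord) eq) (Inverse.strictlyInverseˡ ord j))
    ; index = λ x _ → Inverse.to ord x ; at-index = λ x _ → Inverse.strictlyInverseʳ ord x }

  abstract
    _≟_ : (x y : K) → Dec (x ≡ y)
    x ≟ y = map′ (index-inj Card-K) (cong (Inverse.to ord)) (Inverse.to ord x Finₚ.≟ Inverse.to ord y)

    any? : {P : K → Set} → (∀ x → Dec (P x)) → Dec (∃ P)
    any? {P} P? = map′ (λ { (i , p) → at Card-K i , p }) (λ { (x , p) → index Card-K x tt , subst P (sym (at-index Card-K x tt)) p })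
      (Finₚ.any? (P? ∘ at Card-K))

    Card-dec : (P : K → Set) → (∀ x → Dec (P x)) → ∃ (Card P)
    Card-dec P P? with Card-Fin (P ∘ at Card-K) (P? ∘ at Card-K)
    ... | k , c = k , record
      { at = at Card-K ∘ at c ; at-∈ = at-∈ c ; at-inj = at-inj c ∘ at-inj Card-K
      ; index = λ x p → index c (index Card-K x tt) (subst P (sym (at-index Card-K x tt)) p)
      ; at-index = λ x p → trans (cong (at Card-K) (at-index c _ _)) (at-index Card-K x tt) }

  Card-≤K : ∀ {P k} → Card P k → k ≤ q ℕ.^ n
  Card-≤K c = Card-≤ c Card-K id (λ _ _ → tt) (λ _ _ _ _ → id)

  private
    p e : ℕ
    p = proj₁ pp
    e = proj₁ (proj₂ pp)

    prime-p : Prime p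
    prime-p = proj₁ (proj₂ (proj₂ pp))

    q≡ : q ≡ p ℕ.^ suc e
    q≡ = proj₂ (proj₂ (proj₂ pp))

    2≤p : 2 ≤ p
    2≤p = ℕ.nonTrivial⇒n>1 p {{prime⇒nonTrivial prime-p}}

  2≤q : 2 ≤ q
  2≤q = subst (2 ≤_) (sym q≡) (ℕₚ.≤-trans 2≤p (ℕₚ.≤-trans (ℕₚ.≤-reflexive (sym (ℕₚ.*-identityʳ p)))
          (ℕₚ.*-monoʳ-≤ p (ℕₚ.m^n>0 p {{prime⇒nonZero prime-p}} e))))

  instance
    q-nonZero : ℕ.NonZero q
    q-nonZero = ℕ.>-nonZero (ℕₚ.≤-trans (s≤s z≤n) 2≤q)

  1≤q^ : ∀ s → 1 ≤ q ℕ.^ s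
  1≤q^ s = ℕₚ.m^n>0 q s

  2≤q^ : ∀ {s} → 1 ≤ s → 2 ≤ q ℕ.^ s
  2≤q^ {s} 1≤s = ℕₚ.≤-trans 2≤q (ℕₚ.≤-trans (ℕₚ.≤-reflexive (sym (ℕₚ.*-identityʳ q))) (ℕₚ.^-monoʳ-≤ q 1≤s))

  private
    module S+ = MonoidSum +-commutativeMonoid
    module S* = MonoidSum *-commutativeMonoid
    open SemiringMult semiring using (×1-homo-*; ×-assoc-*; ×-homo-1) renaming (_×_ to _×ₙ_)

    -- Translation by 1 permutes K, so adding 1 to every summand does not change the sum over K.
    |K|×1≡0 : (q ℕ.^ n) ×ₙ 1# ≡ 0#
    |K|×1≡0 = +-cancelˡ (S+.sum e′) _ _ (begin
      S+.sum e′ + N ×ₙ 1#                     ≡⟨ cong (S+.sum e′ +_) (sym (S+.sum-replicate N)) ⟩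
      S+.sum e′ + S+.sum {N} (λ _ → 1#)       ≡⟨ sym (S+.∑-distrib-+ e′ (λ _ → 1#)) ⟩
      S+.sum (λ i → e′ i + 1#)                ≡⟨ S+.sum-cong-≗ {N} (λ i → sym (at-index Card-K _ tt)) ⟩
      S+.sum (λ i → e′ (shift ⟨$⟩ʳ i))        ≡⟨ sym (S+.sum-permute e′ shift) ⟩
      S+.sum e′                               ≡⟨ sym (+-identityʳ _) ⟩
      S+.sum e′ + 0#                          ∎)
      where
      open ≡-Reasoning
      N = q ℕ.^ n
      e′ = at Card-K
      ind : K → Fin N
      ind x = index Card-K x tt
      shift : Permutation′ N
      shift = mk↔ₛ′ (λ i → ind (e′ i + 1#)) (λ i → ind (e′ i + - 1#))
        (λ i → trans (cong (λ x → ind (x + 1#)) (at-index Card-K _ tt))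
          (trans (cong ind (solve 2 (λ x y → x :+ :- y :+ y := x) refl (e′ i) 1#)) (index-at Card-K i)))
        (λ i → trans (cong (λ x → ind (x + - 1#)) (at-index Card-K _ tt))
          (trans (cong ind (solve 2 (λ x y → x :+ y :+ :- y := x) refl (e′ i) 1#)) (index-at Card-K i)))

    -- As |K| is a power of p, a power of the element p·1 is zero. Cancelling factors p·1 one at a
    -- time would end in 1 = 0 if p·1 were nonzero.
    p×1≡0 : p ×ₙ 1# ≡ 0#
    p×1≡0 = go (suc e *ℕ n) (subst (λ m → m ×ₙ 1# ≡ 0#) (trans (cong (ℕ._^ n) q≡) (ℕₚ.^-*-assoc p (suc e) n)) |K|×1≡0)
      where
      go : ∀ k → (p ℕ.^ k) ×ₙ 1# ≡ 0# → p ×ₙ 1# ≡ 0#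
      go zero eq = contradiction (trans (sym eq) (×-homo-1 1#)) 0≢1
      go (suc k) eq with (p ×ₙ 1#) ≟ 0#
      ... | yes z = z
      ... | no nz = go k (*-cancelˡ-0 nz (trans (sym (×1-homo-* p (p ℕ.^ k))) eq))

    p∣m⇒m×x≡0 : ∀ {m} → p ∣ m → ∀ x → m ×ₙ x ≡ 0#
    p∣m⇒m×x≡0 (divides c refl) x = begin
      (c *ℕ p) ×ₙ x             ≡⟨ cong ((c *ℕ p) ×ₙ_) (sym (*-identityˡ x)) ⟩
      (c *ℕ p) ×ₙ (1# * x)      ≡⟨ sym (×-assoc-* (c *ℕ p) 1# x) ⟩
      (c *ℕ p) ×ₙ 1# * x        ≡⟨ cong (_* x) (×1-homo-* c p) ⟩
      c ×ₙ 1# * p ×ₙ 1# * x     ≡⟨ cong (λ u → c ×ₙ 1# * u * x) p×1≡0 ⟩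
      c ×ₙ 1# * 0# * x          ≡⟨ cong (_* x) (zeroʳ _) ⟩
      0# * x                    ≡⟨ zeroˡ x ⟩
      0#                        ∎
      where open ≡-Reasoning

  Additive : ℕ → Set
  Additive a = ∀ x y → (x + y) ^ a ≡ (x ^ a) + (y ^ a)

  private
    open SemiringExp semiring using () renaming (_^_ to _^ₛ_)

    ^≡^ₛ : ∀ x a → x ^ a ≡ x ^ₛ a
    ^≡^ₛ x zero = refl
    ^≡^ₛ x (suc a) = cong (x *_) (^≡^ₛ x a)

    -- Every binomial coefficient strictly between the ends is a multiple of p, hence zero in K. The
    -- successor form of p lets the two outer terms be split off.
    freshman : ∀ {p′} → p ≡ suc (suc p′) → Additive (suc (suc p′))
    freshman {p′} p≡ x y = begin
      (x + y) ^ P                          ≡⟨ ^≡^ₛ (x + y) P ⟩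
      (x + y) ^ₛ P                         ≡⟨ Binomial.theorem commutativeSemiring P x y ⟩
      T zero + S+.sum (T ∘ suc)            ≡⟨ cong₂ _+_ T-first (S+.sum-init-last (T ∘ suc)) ⟩
      y ^ P + (S+.sum (λ i → T (suc (inject₁ i))) + T (suc (fromℕ (suc p′))))
        ≡⟨ cong₂ (λ u v → y ^ P + (u + v)) (trans (S+.sum-cong-≗ {suc p′} T-middle) (S+.sum-replicate-zero (suc p′))) T-last ⟩
      y ^ P + (0# + x ^ P)                 ≡⟨ solve 2 (λ a b → b :+ (con ℤ.0ℤ :+ a) := a :+ b) refl (x ^ P) (y ^ P) ⟩
      x ^ P + y ^ P                        ∎
      where
      open ≡-Reasoning
      P = suc (suc p′)
      T : Fin (suc P) → K
      T = Binomial.binomialTerm commutativeSemiring x y P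
      T-first : T zero ≡ y ^ P
      T-first = trans (×-homo-1 _) (trans (*-identityˡ _) (sym (^≡^ₛ y P)))
      T-middle : ∀ i → T (suc (inject₁ i)) ≡ 0#
      T-middle i = p∣m⇒m×x≡0 {P C suc (toℕ (inject₁ i))} (subst (_∣ (P C suc (toℕ (inject₁ i)))) (sym p≡) (prime∣C (subst Prime p≡ prime-p)
        (subst (_< suc p′) (sym (Finₚ.toℕ-inject₁ i)) (Finₚ.toℕ<n i)))) _
      T-last : T (suc (fromℕ (suc p′))) ≡ x ^ P
      T-last rewrite Finₚ.toℕ-fromℕ p′ | nCn≡1 P | ℕₚ.n∸n≡0 p′ =
        trans (×-homo-1 _) (trans (*-identityʳ _) (sym (^≡^ₛ x P)))

    Additive-p : Additive p
    Additive-p = go p refl 2≤p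
      where
      go : ∀ m → p ≡ m → 2 ≤ m → Additive m
      go (suc (suc p′)) eq _ = freshman eq
      go (suc zero) eq (s≤s ())

    Additive-* : ∀ a b → Additive a → Additive b → Additive (a *ℕ b)
    Additive-* a b A B x y = begin
      (x + y) ^ (a *ℕ b)                  ≡⟨ ^-* (x + y) a b ⟩
      ((x + y) ^ a) ^ b                   ≡⟨ cong (_^ b) (A x y) ⟩
      ((x ^ a) + (y ^ a)) ^ b             ≡⟨ B _ _ ⟩
      ((x ^ a) ^ b) + ((y ^ a) ^ b)       ≡⟨ sym (cong₂ _+_ (^-* x a b) (^-* y a b)) ⟩
      (x ^ (a *ℕ b)) + (y ^ (a *ℕ b))     ∎
      where open ≡-Reasoning

    Additive-^ : ∀ a → Additive a → ∀ k → Additive (a ℕ.^ k)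
    Additive-^ a A zero x y = trans (*-identityʳ _) (sym (cong₂ _+_ (*-identityʳ x) (*-identityʳ y)))
    Additive-^ a A (suc k) = Additive-* a (a ℕ.^ k) A (Additive-^ a A k)

  Additive-q^ : ∀ s → Additive (q ℕ.^ s)
  Additive-q^ s = Additive-^ q (subst Additive (sym q≡) (Additive-^ p Additive-p (suc e))) s

  ^q^-neg : ∀ s x → (- x) ^ (q ℕ.^ s) ≡ - (x ^ (q ℕ.^ s))
  ^q^-neg s x = x-y≡0⇒x≡y (begin
    (- x) ^ Q + - - (x ^ Q)   ≡⟨ cong ((- x) ^ Q +_) (-‿involutive _) ⟩
    (- x) ^ Q + x ^ Q         ≡⟨ sym (Additive-q^ s (- x) x) ⟩
    (- x + x) ^ Q             ≡⟨ cong (_^ Q) (-‿inverseˡ x) ⟩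
    0# ^ Q                    ≡⟨ 0^ (1≤q^ s) ⟩
    0#                        ∎)
    where
    open ≡-Reasoning
    Q = q ℕ.^ s

  -- The product of the nonzero elements of P is unchanged when each of them is multiplied by x.
  fermat : ∀ {P : K → Set} {r} → Card P r → P 0# → (∀ x y → P x → P y → P (x * y)) → ∀ x → P x → x ^ r ≡ x
  fermat {P} {r} c P0 P* x Px with x ≟ 0#
  ... | yes refl = 0^ (ℕₚ.≤-trans (s≤s z≤n) (Finₚ.toℕ<n (index c 0# P0)))
  ... | no x≢0 = trans (sym (g-∏ r (at c) (at-inj c) (index c 0# P0) (at-index c 0# P0)))
                   (trans (cong (x *_) ∏g≡1) (*-identityʳ x))
    where
    -- `nz` replaces 0 by 1, which makes the product over all of `P` nonzero and therefore
    -- cancellable. `g` records the factor gained on multiplying by x, which is 1 at the element 0.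
    nz g : K → K
    nz y with y ≟ 0#
    ... | yes _ = 1#
    ... | no _  = y
    g y with y ≟ 0#
    ... | yes _ = 1#
    ... | no _  = x

    nz≢0 : ∀ y → nz y ≢ 0#
    nz≢0 y with y ≟ 0#
    ... | yes _  = 0≢1 ∘ sym
    ... | no y≢0 = y≢0

    nz-x* : ∀ y → nz (x * y) ≡ g y * nz y
    nz-x* y with y ≟ 0# | (x * y) ≟ 0#
    ... | yes _   | yes _   = sym (*-identityˡ 1#)
    ... | yes y≡0 | no xy≢0 = contradiction (trans (cong (x *_) y≡0) (zeroʳ x)) xy≢0
    ... | no y≢0  | yes xy≡0 = contradiction xy≡0 (*-≢0 x≢0 y≢0)
    ... | no _    | no _    = refl

    g-≢0 : ∀ {y} → y ≢ 0# → g y ≡ x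
    g-≢0 {y} y≢0 with y ≟ 0#
    ... | yes y≡0 = contradiction y≡0 y≢0
    ... | no _ = refl

    g-0 : ∀ {y} → y ≡ 0# → g y ≡ 1#
    g-0 {y} y≡0 with y ≟ 0#
    ... | yes _ = refl
    ... | no y≢0 = contradiction y≡0 y≢0

    all-≢0 : ∀ k (e : Fin k → K) → (∀ i → e i ≢ 0#) → S*.sum (g ∘ e) ≡ x ^ k
    all-≢0 zero e nz = refl
    all-≢0 (suc k) e nz = cong₂ _*_ (g-≢0 (nz zero)) (all-≢0 k (e ∘ suc) (nz ∘ suc))

    -- An enumeration of length k that contains 0 contributes only k - 1 factors x. The additional x
    -- stands in for the entry 0, so the result is x^r = x with no subtraction of exponents.
    g-∏ : ∀ k (e : Fin k → K) → (∀ {i j} → e i ≡ e j → i ≡ j) → ∀ i₀ → e i₀ ≡ 0# → x * S*.sum (g ∘ e) ≡ x ^ k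
    g-∏ (suc k) e inj zero eq = cong (x *_) (trans (cong₂ _*_ (g-0 eq)
      (all-≢0 k (e ∘ suc) λ i z → Finₚ.0≢1+n (inj (trans eq (sym z))))) (*-identityˡ _))
    g-∏ (suc k) e inj (suc i₀) eq = cong (x *_) (trans (cong (_* S*.sum (g ∘ e ∘ suc))
      (g-≢0 {e zero} λ z → Finₚ.0≢1+n (inj (trans z (sym eq)))))
      (g-∏ k (e ∘ suc) (λ {i} {j} eq → Finₚ.suc-injective (inj eq)) i₀ eq))

    σ : Fin r → Fin r
    σ i = index c (x * at c i) (P* _ _ Px (at-∈ c i))

    σ-inj : Injective _≡_ _≡_ σ
    σ-inj eq = at-inj c (*-cancelˡ x≢0 (index-inj c eq))

    σ⁻¹ : ∀ j → ∃ λ i → σ i ≡ j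
    σ⁻¹ = injective⇒surjective σ σ-inj ℕₚ.≤-refl

    π : Permutation′ r
    π = mk↔ₛ′ σ (proj₁ ∘ σ⁻¹) (proj₂ ∘ σ⁻¹) (λ i → σ-inj (proj₂ (σ⁻¹ (σ i))))

    ∏ : K
    ∏ = S*.sum (nz ∘ at c)

    ∏≢0 : ∀ k (e : Fin k → K) → S*.sum (nz ∘ e) ≢ 0#
    ∏≢0 zero e = 0≢1 ∘ sym
    ∏≢0 (suc k) e = *-≢0 (nz≢0 _) (∏≢0 k (e ∘ suc))

    ∏g≡1 : S*.sum (g ∘ at c) ≡ 1#
    ∏g≡1 = *-cancelˡ (∏≢0 r (at c)) (begin
      ∏ * S*.sum (g ∘ at c)                 ≡⟨ *-comm _ _ ⟩
      S*.sum (g ∘ at c) * ∏                 ≡⟨ sym (S*.∑-distrib-+ (g ∘ at c) (nz ∘ at c)) ⟩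
      S*.sum (λ i → g (at c i) * nz (at c i)) ≡⟨ S*.sum-cong-≗ {r} (λ i → trans (sym (nz-x* (at c i))) (cong nz (sym (at-index c _ _)))) ⟩
      S*.sum (λ i → nz (at c (π ⟨$⟩ʳ i)))   ≡⟨ sym (S*.sum-permute (nz ∘ at c) π) ⟩
      ∏                                     ≡⟨ sym (*-identityʳ ∏) ⟩
      ∏ * 1#                                ∎)
      where open ≡-Reasoning

  ^|K| : ∀ x → x ^ (q ℕ.^ n) ≡ x
  ^|K| x = fermat Card-K tt (λ _ _ _ _ → tt) x tt

-- The trace form and the order of the subfield F_q

module TraceForm (F : Field) (q n : ℕ) (pp : IsPrimePower q) (1≤n : 1 ≤ n) (ord : Over.HasOrder F q n) where
  open FiniteField F q n pp 1≤n ord public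

  𝔽? : ∀ s x → Dec (𝔽 s x)
  𝔽? s x = (x ^ (q ℕ.^ s)) ≟ x

  𝔽-0 : ∀ s → 𝔽 s 0#
  𝔽-0 s = 0^ (1≤q^ s)

  𝔽-1 : ∀ s → 𝔽 s 1#
  𝔽-1 s = 1^ (q ℕ.^ s)

  𝔽-+ : ∀ s {x y} → 𝔽 s x → 𝔽 s y → 𝔽 s (x + y)
  𝔽-+ s {x} {y} a b = trans (Additive-q^ s x y) (cong₂ _+_ a b)

  𝔽-neg : ∀ s {x} → 𝔽 s x → 𝔽 s (- x)
  𝔽-neg s {x} a = trans (^q^-neg s x) (cong -_ a)

  𝔽-* : ∀ s {x y} → 𝔽 s x → 𝔽 s y → 𝔽 s (x * y)
  𝔽-* s {x} {y} a b = trans (^-distrib-* x y (q ℕ.^ s)) (cong₂ _*_ a b)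

  𝔽-⁻¹ : ∀ s {x} → x ≢ 0# → 𝔽 s x → 𝔽 s (x ⁻¹)
  𝔽-⁻¹ s {x} x≢0 a = *-cancelˡ x≢0 (begin
    x * ((x ⁻¹) ^ Q)         ≡⟨ cong (_* ((x ⁻¹) ^ Q)) (sym a) ⟩
    (x ^ Q) * ((x ⁻¹) ^ Q)   ≡⟨ sym (^-distrib-* x (x ⁻¹) Q) ⟩
    (x * (x ⁻¹)) ^ Q         ≡⟨ cong (_^ Q) (⁻¹-inverse x x≢0) ⟩
    1# ^ Q                   ≡⟨ 1^ Q ⟩
    1#                       ≡⟨ sym (⁻¹-inverse x x≢0) ⟩
    x * (x ⁻¹)               ∎)
    where
    open ≡-Reasoning
    Q = q ℕ.^ s

  𝔽-∑ : ∀ s k {f : Fin k → K} → (∀ i → 𝔽 s (f i)) → 𝔽 s (∑ k f)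
  𝔽-∑ s zero a = 𝔽-0 s
  𝔽-∑ s (suc k) a = 𝔽-+ s (a zero) (𝔽-∑ s k (a ∘ suc))

  Fq⇒^q : ∀ {x} → Fq x → x ^ q ≡ x
  Fq⇒^q {x} = trans (cong (x ^_) (sym (ℕₚ.*-identityʳ q)))

  Fq⊆𝔽 : ∀ s {x} → Fq x → 𝔽 s x
  Fq⊆𝔽 zero {x} _ = *-identityʳ x
  Fq⊆𝔽 (suc s) {x} a = trans (^-* x q (q ℕ.^ s)) (trans (cong (_^ (q ℕ.^ s)) (Fq⇒^q a)) (Fq⊆𝔽 s a))

  Tr-+ : ∀ x y → Tr (x + y) ≡ Tr x + Tr y
  Tr-+ x y = trans (∑-cong n (λ i → Additive-q^ (toℕ i) x y)) (∑-+ n _ _)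

  Tr-* : ∀ {l} x → Fq l → Tr (l * x) ≡ l * Tr x
  Tr-* {l} x a = trans (∑-cong n (λ i → trans (^-distrib-* l x (q ℕ.^ toℕ i)) (cong (_* (x ^ (q ℕ.^ toℕ i))) (Fq⊆𝔽 (toℕ i) a))))
    (sym (∑-*ˡ n l _))

  Tr-0 : Tr 0# ≡ 0#
  Tr-0 = ∑-0 n (λ i → 0^ (1≤q^ (toℕ i)))

  Tr-neg : ∀ x → Tr (- x) ≡ - Tr x
  Tr-neg x = x-y≡0⇒x≡y (begin
    Tr (- x) + - - Tr x  ≡⟨ cong (Tr (- x) +_) (-‿involutive _) ⟩
    Tr (- x) + Tr x      ≡⟨ sym (Tr-+ (- x) x) ⟩
    Tr (- x + x)         ≡⟨ cong Tr (-‿inverseˡ x) ⟩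
    Tr 0#                ≡⟨ Tr-0 ⟩
    0#                   ∎)
    where open ≡-Reasoning

  Tr-∑ : ∀ k (l v : Fin k → K) → (∀ i → Fq (l i)) → Tr (∑ k (λ i → l i * v i)) ≡ ∑ k (λ i → l i * Tr (v i))
  Tr-∑ zero l v a = Tr-0
  Tr-∑ (suc k) l v a = trans (Tr-+ _ _) (cong₂ _+_ (Tr-* _ (a zero)) (Tr-∑ k (l ∘ suc) (v ∘ suc) (a ∘ suc)))

  private
    ∑-^q : ∀ s k (f : Fin k → K) → ∑ k f ^ (q ℕ.^ s) ≡ ∑ k (λ i → f i ^ (q ℕ.^ s))
    ∑-^q s zero f = 0^ (1≤q^ s)
    ∑-^q s (suc k) f = trans (Additive-q^ s _ _) (cong (f zero ^ (q ℕ.^ s) +_) (∑-^q s k (f ∘ suc)))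

    ∑-shift : ∀ k (g : ℕ → K) → g k ≡ g 0 → ∑ k (λ i → g (suc (toℕ i))) ≡ ∑ k (λ i → g (toℕ i))
    ∑-shift k g eq = +-cancelˡ (g 0) _ _ (begin
      ∑ (suc k) (λ i → g (toℕ i))                             ≡⟨ ∑-snoc k (λ i → g (toℕ i)) ⟩
      ∑ k (λ i → g (toℕ (inject₁ i))) + g (toℕ (fromℕ k))     ≡⟨ cong₂ _+_ (∑-cong k (λ i → cong g (Finₚ.toℕ-inject₁ i))) (trans (cong g (Finₚ.toℕ-fromℕ k)) eq) ⟩
      ∑ k (λ i → g (toℕ i)) + g 0                             ≡⟨ +-comm _ _ ⟩
      g 0 + ∑ k (λ i → g (toℕ i))                             ∎)
      where open ≡-Reasoning

    ^q-∘ : ∀ x s → (x ^ q) ^ (q ℕ.^ s) ≡ x ^ (q ℕ.^ suc s)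
    ^q-∘ x s = sym (^-* x q (q ℕ.^ s))

  -- Raising to the power q shifts the summands by one place, and x^(q^n) = x closes the cycle.
  Tr-^q : ∀ x → Tr (x ^ q) ≡ Tr x
  Tr-^q x = trans (∑-cong n (λ i → ^q-∘ x (toℕ i)))
    (∑-shift n (λ s → x ^ (q ℕ.^ s)) (trans (^|K| x) (sym (*-identityʳ x))))

  Tr-∈Fq : ∀ x → Fq (Tr x)
  Tr-∈Fq x = begin
    Tr x ^ (q ℕ.^ 1)                                   ≡⟨ ∑-^q 1 n _ ⟩
    ∑ n (λ i → (x ^ (q ℕ.^ toℕ i)) ^ (q ℕ.^ 1))        ≡⟨ ∑-cong n (λ i → swap (toℕ i)) ⟩
    Tr (x ^ q)                                         ≡⟨ Tr-^q x ⟩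
    Tr x                                               ∎
    where
    open ≡-Reasoning
    swap : ∀ s → (x ^ (q ℕ.^ s)) ^ (q ℕ.^ 1) ≡ (x ^ q) ^ (q ℕ.^ s)
    swap s = trans (cong ((x ^ (q ℕ.^ s)) ^_) (ℕₚ.*-identityʳ q))
      (trans (sym (^-* x (q ℕ.^ s) q)) (trans (cong (x ^_) (ℕₚ.*-comm (q ℕ.^ s) q)) (^-* x q (q ℕ.^ s))))

  private
    Deg-∑ : ∀ d k {f : Fin k → K → K} → (∀ i → Deg (suc d) 0# (f i)) → Deg (suc d) 0# (λ x → ∑ k (λ i → f i x))
    Deg-∑ d zero D = Deg-const d 0#
    Deg-∑ d (suc k) {f} D = subst (λ a → Deg (suc d) a (λ x → ∑ (suc k) (λ i → f i x))) (+-identityˡ 0#) (Deg-+ (suc d) (D zero) (Deg-∑ d k (D ∘ suc)))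

    Deg-Frobenius-sum : ∀ k → Deg (q ℕ.^ k) 1# (λ x → ∑ (suc k) (λ i → x ^ (q ℕ.^ toℕ i)))
    Deg-Frobenius-sum k = Deg-cong (q ℕ.^ k) (λ x → sym (∑-snoc k (λ i → x ^ (q ℕ.^ toℕ i))))
      (subst (λ a → Deg (q ℕ.^ k) a (λ x → ∑ k (λ i → x ^ (q ℕ.^ toℕ (inject₁ i))) + x ^ (q ℕ.^ toℕ (fromℕ k)))) (+-identityˡ 1#) (Deg-+ (q ℕ.^ k) lower top))
      where
      lower : Deg (q ℕ.^ k) 0# (λ x → ∑ k (λ i → x ^ (q ℕ.^ toℕ (inject₁ i))))
      lower = subst (λ d → Deg d 0# (λ x → ∑ k (λ i → x ^ (q ℕ.^ toℕ (inject₁ i))))) suc-pred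
        (Deg-∑ (ℕ.pred (q ℕ.^ k)) k (λ i → subst (λ d → Deg d 0# (_^ (q ℕ.^ toℕ (inject₁ i)))) (sym suc-pred)
          (Deg-< (ℕₚ.^-monoʳ-< q 2≤q (subst (_< k) (sym (Finₚ.toℕ-inject₁ i)) (Finₚ.toℕ<n i))) (Deg-^ (q ℕ.^ toℕ (inject₁ i))))))
        where
        suc-pred : suc (ℕ.pred (q ℕ.^ k)) ≡ q ℕ.^ k
        suc-pred = ℕₚ.suc-pred (q ℕ.^ k) {{ℕ.>-nonZero (1≤q^ k)}}
      top : Deg (q ℕ.^ k) 1# (λ x → x ^ (q ℕ.^ toℕ (fromℕ k)))
      top = subst (λ m → Deg (q ℕ.^ k) 1# (λ x → x ^ (q ℕ.^ m))) (sym (Finₚ.toℕ-fromℕ k)) (Deg-^ (q ℕ.^ k))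

    n≡ : suc (ℕ.pred n) ≡ n
    n≡ = ℕₚ.suc-pred n {{ℕ.>-nonZero 1≤n}}

    Deg-Tr : Deg (q ℕ.^ ℕ.pred n) 1# Tr
    Deg-Tr = subst (λ m → Deg (q ℕ.^ ℕ.pred n) 1# (λ x → ∑ m (λ i → x ^ (q ℕ.^ toℕ i)))) n≡ (Deg-Frobenius-sum (ℕ.pred n))

    1≢0 : 1# ≢ 0#
    1≢0 = 0≢1 ∘ sym

  Card-kerTr-≤ : ∀ {k} → Card (λ x → Tr x ≡ 0#) k → k ≤ q ℕ.^ ℕ.pred n
  Card-kerTr-≤ c = roots≤Deg (q ℕ.^ ℕ.pred n) 1≢0 Deg-Tr _ (at c) (at-inj c) (at-∈ c)

  -- A nonzero ξ satisfies ξK = K, so Tr would vanish on all q^n elements, more than its degree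
  -- q^(n-1) allows.
  Tr-nondegenerate : ∀ {ξ} → (∀ x → Tr (ξ * x) ≡ 0#) → ξ ≡ 0#
  Tr-nondegenerate {ξ} zero-on-K with ξ ≟ 0#
  ... | yes ξ≡0 = ξ≡0
  ... | no ξ≢0 = contradiction
    (roots≤Deg (q ℕ.^ ℕ.pred n) 1≢0 Deg-Tr (q ℕ.^ n) (at Card-K) (at-inj Card-K) (λ i → Tr≡0 (at Card-K i)))
    (ℕₚ.<⇒≱ (ℕₚ.^-monoʳ-< q 2≤q (ℕₚ.≤-reflexive n≡)))
    where
    Tr≡0 : ∀ x → Tr x ≡ 0#
    Tr≡0 x = trans (cong Tr (trans (sym (*-identityˡ x)) (trans (cong (_* x) (sym (⁻¹-inverse ξ ξ≢0))) (*-assoc _ _ _))))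
      (zero-on-K ((ξ ⁻¹) * x))

  -- The elements are roots of x^(q^s) - x; `1 ≤ s` keeps the linear term below the leading one, so
  -- the polynomial is monic of degree q^s.
  Card-𝔽-≤ : ∀ {s k} → 1 ≤ s → Card (𝔽 s) k → k ≤ q ℕ.^ s
  Card-𝔽-≤ {s} 1≤s c = roots≤Deg (q ℕ.^ s) 1≢0
    (subst (λ a → Deg (q ℕ.^ s) a (λ x → (x ^ (q ℕ.^ s)) + - 1# * x)) (+-identityʳ 1#)
      (Deg-+ (q ℕ.^ s) (Deg-^ (q ℕ.^ s)) (Deg-< (2≤q^ 1≤s) (Deg-cong 1 (λ x → cong (- 1# *_) (*-identityʳ x)) (Deg-*ˡ 1 (- 1#) (Deg-^ 1))))))
    _ (at c) (at-inj c)
    (λ i → trans (cong₂ _+_ (at-∈ c i) (solve 1 (λ x → :- con ℤ.1ℤ :* x := :- x) refl (at c i))) (-‿inverseʳ _))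

  -- An additive map is split by a section `preimage` of its image, with the arbitrary value 0
  -- elsewhere: x corresponds to the pair of x minus the section at φ x, in the kernel, and φ x. The
  -- two inequalities are kept apart because `Q` may be larger than the image in the first, as ker
  -- Tr is for x^q - x.
  module RankNullity (φ : K → K) (φ-+ : ∀ x y → φ (x + y) ≡ φ x + φ y) where

    φ-- : ∀ x y → φ (x + - y) ≡ φ x + - φ y
    φ-- x y = +-cancelʳ (φ y) _ _ (trans (sym (φ-+ (x + - y) y)) (trans
      (cong φ (solve 2 (λ x y → x :+ :- y :+ y := x) refl x y)) (solve 2 (λ x y → x := x :+ :- y :+ y) refl (φ x) (φ y))))

    preimage : K → K
    preimage y with any? (λ x → φ x ≟ y)
    ... | yes (x , _) = x
    ... | no _ = 0#

    φ-preimage : ∀ y → ∃ (λ x → φ x ≡ y) → φ (preimage y) ≡ y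
    φ-preimage y y∈ with any? (λ x → φ x ≟ y)
    ... | yes (x , eq) = eq
    ... | no ¬y∈ = contradiction y∈ ¬y∈

    |K|≤|ker|*|im| : ∀ {Q r k} → Card (λ x → φ x ≡ 0#) r → Card Q k → (∀ x → Q (φ x)) → q ℕ.^ n ≤ r *ℕ k
    |K|≤|ker|*|im| cK cQ φ∈Q = Card-≤ Card-K (Card-× cK cQ) (λ x → (x + - preimage (φ x)) , φ x)
      (λ x _ → trans (φ-- x _) (x≡y⇒x-y≡0 (sym (φ-preimage (φ x) (x , refl)))) , φ∈Q x)
      (λ x y _ _ eq → +-cancelʳ (- preimage (φ x)) x y (trans (cong proj₁ eq) (cong (λ z → y + - preimage z) (sym (cong proj₂ eq)))))

    |ker|*|im|≤|K| : ∀ {Q r k} → Card (λ x → φ x ≡ 0#) r → Card Q k → (∀ y → Q y → ∃ λ x → φ x ≡ y) → r *ℕ k ≤ q ℕ.^ n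
    |ker|*|im|≤|K| cK cQ Q⊆ = Card-≤ (Card-× cK cQ) Card-K (λ { (x , y) → x + preimage y }) (λ _ _ → tt) inj
      where
      value : ∀ x y → φ x ≡ 0# → ∃ (λ x → φ x ≡ y) → φ (x + preimage y) ≡ y
      value x y φx≡0 y∈ = trans (φ-+ x _) (trans (cong₂ _+_ φx≡0 (φ-preimage y y∈)) (+-identityˡ y))
      inj : ∀ u v → _ → _ → _ → u ≡ v
      inj (x , y) (x′ , y′) (a , b) (a′ , b′) eq = cong₂ _,_ (+-cancelʳ (preimage y) x x′ (trans eq (cong (λ z → x′ + preimage z) (sym y≡y′)))) y≡y′
        where
        y≡y′ : y ≡ y′
        y≡y′ = trans (sym (value x y a (Q⊆ y b))) (trans (cong φ eq) (value x′ y′ a′ (Q⊆ y′ b′)))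

  -- x ↦ x^q - x has kernel F_q and image inside ker Tr, which has at most q^(n-1) elements; hence |F_q| ≥ q.
  abstract
    Card-Fq : Card Fq q
    Card-Fq with Card-dec Fq (𝔽? 1) | Card-dec (λ x → Tr x ≡ 0#) (λ x → Tr x ≟ 0#)
    ... | r , c | k , cT = subst (Card Fq) (ℕₚ.≤-antisym r≤q q≤r) c
      where
      r≤q : r ≤ q
      r≤q = subst (r ≤_) (ℕₚ.*-identityʳ q) (Card-𝔽-≤ {1} (s≤s z≤n) c)

      φ : K → K
      φ x = (x ^ (q ℕ.^ 1)) + - x

      φ-+ : ∀ x y → φ (x + y) ≡ φ x + φ y
      φ-+ x y = trans (cong (_+ - (x + y)) (Additive-q^ 1 x y))
        (solve 4 (λ a b x y → (a :+ b) :+ :- (x :+ y) := (a :+ :- x) :+ (b :+ :- y)) refl (x ^ (q ℕ.^ 1)) (y ^ (q ℕ.^ 1)) x y)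

      cK : Card (λ x → φ x ≡ 0#) r
      cK = record { at = at c ; at-∈ = λ i → x≡y⇒x-y≡0 (at-∈ c i) ; at-inj = at-inj c
                  ; index = λ x p → index c x (x-y≡0⇒x≡y p) ; at-index = λ x p → at-index c x _ }

      Trφ≡0 : ∀ x → Tr (φ x) ≡ 0#
      Trφ≡0 x = trans (Tr-+ _ _) (trans (cong₂ _+_ (trans (cong (λ m → Tr (x ^ m)) (ℕₚ.*-identityʳ q)) (Tr-^q x)) (Tr-neg x)) (-‿inverseʳ _))

      q≤r : q ≤ r
      q≤r = ℕₚ.*-cancelʳ-≤ q r (q ℕ.^ ℕ.pred n) {{ℕ.>-nonZero (1≤q^ (ℕ.pred n))}} (begin
        q *ℕ q ℕ.^ ℕ.pred n   ≡⟨ cong (q ℕ.^_) n≡ ⟩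
        q ℕ.^ n               ≤⟨ RankNullity.|K|≤|ker|*|im| φ φ-+ cK cT Trφ≡0 ⟩
        r *ℕ k                ≤⟨ ℕₚ.*-monoʳ-≤ r (Card-kerTr-≤ cT) ⟩
        r *ℕ q ℕ.^ ℕ.pred n   ∎)
        where open ℕₚ.≤-Reasoning

-- Linear algebra over a finite subfield, used for both F_q and F_q(b)

module LinearAlgebra (F : Field) (q n : ℕ) (pp : IsPrimePower q) (1≤n : 1 ≤ n) (ord : Over.HasOrder F q n)
                     (s r : ℕ) (Card-S : Card (Over.𝔽 F q n s) r) where
  open TraceForm F q n pp 1≤n ord
  open Lin K-VS (𝔽 s) using (IsSubspace; HasDim; comb)

  lc : ∀ k → (Fin k → K) → (Fin k → K) → K
  lc k l v = ∑ k (λ i → l i * v i)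

  Scalars : ∀ k → (Fin k → K) → Set
  Scalars k l = ∀ i → 𝔽 s (l i)

  Indep : ∀ k → (Fin k → K) → Set
  Indep k v = ∀ l → Scalars k l → lc k l v ≡ 0# → ∀ i → l i ≡ 0#

  InSpan : ∀ k → (Fin k → K) → K → Set
  InSpan k v x = Σ (Fin k → K) λ l → Scalars k l × x ≡ lc k l v

  2≤r : 2 ≤ r
  2≤r = go r Card-S
    where
    go : ∀ m → Card (𝔽 s) m → 2 ≤ m
    go zero c = contradiction (index c 0# (𝔽-0 s)) Finₚ.¬Fin0
    go (suc zero) c = contradiction (index-inj c {p = 𝔽-0 s} {p′ = 𝔽-1 s} (Fin1 _ _)) 0≢1
      where
      Fin1 : (i j : Fin 1) → i ≡ j
      Fin1 zero zero = refl
    go (suc (suc m)) c = s≤s (s≤s z≤n)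

  lc-cong : ∀ k {l l′} v → (∀ i → l i ≡ l′ i) → lc k l v ≡ lc k l′ v
  lc-cong k v eq = ∑-cong k (λ i → cong (_* v i) (eq i))

  lc-+ : ∀ k l l′ v → lc k l v + lc k l′ v ≡ lc k (λ i → l i + l′ i) v
  lc-+ k l l′ v = trans (sym (∑-+ k _ _)) (∑-cong k (λ i → sym (distribʳ _ _ _)))

  lc-* : ∀ k c l v → c * lc k l v ≡ lc k (λ i → c * l i) v
  lc-* k c l v = trans (∑-*ˡ k c _) (∑-cong k (λ i → sym (*-assoc _ _ _)))

  lc-*ʳ : ∀ k c l v → c * lc k l v ≡ lc k l (λ i → c * v i)
  lc-*ʳ k c l v = trans (∑-*ˡ k c _) (∑-cong k (λ i → solve 3 (λ c l v → c :* (l :* v) := l :* (c :* v)) refl c (l i) (v i)))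

  lc-- : ∀ k l l′ v → lc k l v + - lc k l′ v ≡ lc k (λ i → l i + - l′ i) v
  lc-- k l l′ v = begin
    lc k l v + - lc k l′ v               ≡⟨ solve 2 (λ x y → x :+ :- y := x :+ (:- con ℤ.1ℤ) :* y) refl (lc k l v) (lc k l′ v) ⟩
    lc k l v + - 1# * lc k l′ v          ≡⟨ cong (lc k l v +_) (lc-* k (- 1#) l′ v) ⟩
    lc k l v + lc k (λ i → - 1# * l′ i) v ≡⟨ lc-+ k _ _ v ⟩
    lc k (λ i → l i + - 1# * l′ i) v     ≡⟨ lc-cong k v (λ i → solve 2 (λ x y → x :+ (:- con ℤ.1ℤ) :* y := x :+ :- y) refl (l i) (l′ i)) ⟩
    lc k (λ i → l i + - l′ i) v          ∎
    where open ≡-Reasoning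

  Indep-inj : ∀ k {v} → Indep k v → ∀ {l l′} → Scalars k l → Scalars k l′ → lc k l v ≡ lc k l′ v → ∀ i → l i ≡ l′ i
  Indep-inj k {v} ind {l} {l′} a a′ eq i = x-y≡0⇒x≡y (ind (λ i → l i + - l′ i) (λ i → 𝔽-+ s (a i) (𝔽-neg s (a′ i)))
    (trans (sym (lc-- k l l′ v)) (x≡y⇒x-y≡0 eq)) i)

  InSpan-isSubspace : ∀ k v → IsSubspace (InSpan k v)
  InSpan-isSubspace k v =
      ((λ _ → 0#) , (λ _ → 𝔽-0 s) , sym (∑-0 k (λ i → zeroˡ (v i))))
    , (λ { x y (l , a , refl) (l′ , a′ , refl) → (λ i → l i + l′ i) , (λ i → 𝔽-+ s (a i) (a′ i)) , lc-+ k l l′ v })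
    , (λ { c x Sc (l , a , refl) → (λ i → c * l i) , (λ i → 𝔽-* s Sc (a i)) , lc-* k c l v })

  InSpan-member : ∀ k v i → InSpan k v (v i)
  InSpan-member (suc k) v zero = 1# ∷ (λ _ → 0#) , (λ { zero → 𝔽-1 s ; (suc i) → 𝔽-0 s })
    , sym (trans (cong₂ _+_ (*-identityˡ _) (∑-0 k (λ i → zeroˡ (v (suc i))))) (+-identityʳ _))
  InSpan-member (suc k) v (suc i) with InSpan-member k (v ∘ suc) i
  ... | l , a , eq = 0# ∷ l , (λ { zero → 𝔽-0 s ; (suc i) → a i })
    , trans eq (sym (trans (cong (_+ lc k l (v ∘ suc)) (zeroˡ _)) (+-identityˡ _)))

  ∑-∈ : ∀ {U : K → Set} → IsSubspace U → ∀ k {f} → (∀ i → U (f i)) → U (∑ k f)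
  ∑-∈ sub zero f∈ = proj₁ sub
  ∑-∈ sub (suc k) f∈ = proj₁ (proj₂ sub) _ _ (f∈ zero) (∑-∈ sub k (f∈ ∘ suc))

  lc-∈ : ∀ {U : K → Set} → IsSubspace U → ∀ k {l v} → Scalars k l → (∀ i → U (v i)) → U (lc k l v)
  lc-∈ sub k a v∈ = ∑-∈ sub k (λ i → proj₂ (proj₂ sub) _ _ (a i) (v∈ i))

  InSpan-⊆ : ∀ {U : K → Set} → IsSubspace U → ∀ k {v} → (∀ i → U (v i)) → ∀ x → InSpan k v x → U x
  InSpan-⊆ sub k v∈ x (l , a , refl) = lc-∈ sub k a v∈

  abstract
    InSpan? : ∀ k v x → Dec (InSpan k v x)
    InSpan? k v x = map′ (λ { (j , eq) → tuple j , tuple-∈ j , eq })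
      (λ { (l , a , eq) → tuple-index l a , trans eq (lc-cong k v (λ i → sym (tuple-tuple-index l a i))) })
      (Finₚ.any? (λ j → x ≟ lc k (tuple j) v))
      where open Tuples Card-S k

  Card-span : ∀ k v → Indep k v → Card (InSpan k v) (r ℕ.^ k)
  Card-span k v ind = record
    { at       = λ j → lc k (tuple j) v
    ; at-∈     = λ j → tuple j , tuple-∈ j , refl
    ; at-inj   = λ {i} {j} eq → tuple-inj i j (Indep-inj k ind (tuple-∈ i) (tuple-∈ j) eq)
    ; index    = λ { x (l , a , _) → tuple-index l a }
    ; at-index = λ { x (l , a , eq) → trans (lc-cong k v (tuple-tuple-index l a)) (sym eq) } }
    where open Tuples Card-S k

  abstract
    -- The span lies in `U` and already has at least as many elements.
    Indep-full : ∀ k {v} {U : K → Set} {m} → Indep k v → IsSubspace U → (∀ i → U (v i)) → Card U m → m ≤ r ℕ.^ k → ∀ u → U u → InSpan k v u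
    Indep-full k {v} ind sub v∈ c m≤ u Uu = subst (InSpan k v) (proj₂ (proj₂ found)) (proj₁ (proj₂ found))
      where
      found : ∃ λ x → InSpan k v x × x ≡ u
      found = Card-surjective (Card-span k v ind) c id (InSpan-⊆ sub k v∈) (λ _ _ _ _ → id) m≤ u Uu

  Indep⇒≤|K| : ∀ k {v} → Indep k v → r ℕ.^ k ≤ q ℕ.^ n
  Indep⇒≤|K| k ind = Card-≤K (Card-span k _ ind)

  Indep-∷ : ∀ k {v w} → Indep k v → ¬ InSpan k v w → Indep (suc k) (w ∷ v)
  Indep-∷ k {v} {w} ind w∉ l a eq = λ { zero → l₀≡0 ; (suc i) → ind (l ∘ suc) (a ∘ suc) tail≡0 i }
    where
    rest = lc k (l ∘ suc) v
    l₀≡0 : l zero ≡ 0#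
    l₀≡0 with l zero ≟ 0#
    ... | yes z = z
    ... | no nz = contradiction (subst (InSpan k v) w≡ (proj₂ (proj₂ (InSpan-isSubspace k v)) (- (l zero ⁻¹)) rest
                    (𝔽-neg s (𝔽-⁻¹ s nz (a zero))) (l ∘ suc , a ∘ suc , refl))) w∉
      where
      open ≡-Reasoning
      w≡ : - (l zero ⁻¹) * rest ≡ w
      w≡ = begin
        - (l zero ⁻¹) * rest
          ≡⟨ solve 4 (λ l m w x → (:- m) :* x := l :* m :* w :+ (:- m) :* (l :* w :+ x)) refl (l zero) (l zero ⁻¹) w rest ⟩
        l zero * (l zero ⁻¹) * w + - (l zero ⁻¹) * (l zero * w + rest)
          ≡⟨ cong₂ (λ u v → u * w + - (l zero ⁻¹) * v) (⁻¹-inverse _ nz) eq ⟩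
        1# * w + - (l zero ⁻¹) * 0#
          ≡⟨ solve 2 (λ w m → con ℤ.1ℤ :* w :+ m :* con ℤ.0ℤ := w) refl w (- (l zero ⁻¹)) ⟩
        w ∎
    tail≡0 : rest ≡ 0#
    tail≡0 = trans (sym (trans (cong (λ z → z * w + rest) l₀≡0) (trans (cong (_+ rest) (zeroˡ w)) (+-identityˡ rest)))) eq

  abstract
    -- Basis extension as an induction principle: a property proved for bases of `U` descends each
    -- time an adjoined vector is dropped. The fuel |K| suffices because k < r^k ≤ |K| for an
    -- independent family.
    extension-induction : ∀ {U : K → Set} → (∀ x → Dec (U x)) → (P : ∀ k → (Fin k → K) → Set) →
      (∀ k v → Indep k v → (∀ i → U (v i)) → (∀ u → U u → InSpan k v u) → P k v) →
      (∀ k v w → P (suc k) (w ∷ v) → P k v) →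
      ∀ k v → Indep k v → (∀ i → U (v i)) → P k v
    extension-induction {U} U? P base step k₀ v₀ = go (q ℕ.^ n) k₀ v₀ (ℕₚ.m≤n+m _ k₀)
      where
      go : ∀ fuel k v → q ℕ.^ n ≤ k ℕ.+ fuel → Indep k v → (∀ i → U (v i)) → P k v
      go zero k v le ind v∈ = contradiction
        (ℕₚ.≤-trans (n<q^n 2≤r k) (ℕₚ.≤-trans (Indep⇒≤|K| k ind) (subst (q ℕ.^ n ≤_) (ℕₚ.+-identityʳ k) le))) ℕₚ.1+n≰n
      go (suc fuel) k v le ind v∈ = extend (any? (λ x → U? x ×-dec ¬? (InSpan? k v x)))
        where
        extend : Dec (∃ λ x → U x × ¬ InSpan k v x) → P k v
        extend (yes (w , Uw , w∉)) = step k v w (go fuel (suc k) (w ∷ v) (subst (q ℕ.^ n ≤_) (ℕₚ.+-suc k fuel) le)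
                                       (Indep-∷ k ind w∉) (λ { zero → Uw ; (suc i) → v∈ i }))
        extend (no none) = base k v ind v∈ (λ u Uu → decidable-stable (InSpan? k v u) (λ u∉ → none (u , Uu , u∉)))

  Basis : (K → Set) → ∀ k → (Fin k → K) → Set
  Basis U k v = Indep k v × (∀ i → U (v i)) × (∀ u → U u → InSpan k v u)

  abstract
    basis-exists : ∀ {U : K → Set} → (∀ x → Dec (U x)) → ∃ λ k → Σ (Fin k → K) λ v → Basis U k v
    basis-exists {U} U? = extension-induction U? (λ _ _ → ∃ λ k → Σ (Fin k → K) λ v → Basis U k v)
      (λ k v ind v∈ sp → k , v , ind , v∈ , sp) (λ _ _ _ → id) 0 (λ ()) (λ _ _ _ ()) (λ ())

  Basis⇒Card : ∀ {U : K → Set} → IsSubspace U → ∀ k v → Basis U k v → Card U (r ℕ.^ k)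
  Basis⇒Card sub k v (ind , v∈ , sp) = record
    { at = at c ; at-∈ = λ i → InSpan-⊆ sub k v∈ _ (at-∈ c i) ; at-inj = at-inj c
    ; index = λ x p → index c x (sp x p) ; at-index = λ x p → at-index c x (sp x p) }
    where c = Card-span k v ind

  comb≡lc : ∀ k l v → comb k l v ≡ lc k l v
  comb≡lc zero l v = refl
  comb≡lc (suc k) l v = cong (l zero * v zero +_) (comb≡lc k (l ∘ suc) (v ∘ suc))

  Basis⇒HasDim : ∀ {U} k v → Basis U k v → HasDim U k
  Basis⇒HasDim k v (ind , v∈ , sp) = v , v∈
    , (λ l a eq → ind l a (trans (sym (comb≡lc k l v)) eq))
    , (λ u Uu → let (l , a , eq) = sp u Uu in l , a , trans eq (sym (comb≡lc k l v)))

  Dependent : ∀ k → (Fin k → K) → Set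
  Dependent k v = Σ (Fin k → K) λ l → Scalars k l × lc k l v ≡ 0# × ∃ λ i → l i ≢ 0#

  abstract
    -- Finitely many coefficient vectors can be searched. The negative case delivers an explicit
    -- relation, whose coefficients are used later.
    indep⊎dependent : ∀ k v → Indep k v ⊎ Dependent k v
    indep⊎dependent k v with Finₚ.any? (λ j → (lc k (tuple j) v ≟ 0#) ×-dec Finₚ.any? (λ i → ¬? (tuple j i ≟ 0#)))
      where open Tuples Card-S k
    ... | yes (j , eq , nz) = inj₂ (tuple j , tuple-∈ j , eq , nz)
      where open Tuples Card-S k
    ... | no none = inj₁ λ l a eq i → decidable-stable (l i ≟ 0#) λ nz → none
      (tuple-index l a , trans (lc-cong k v (tuple-tuple-index l a)) eq , i , λ z → nz (trans (sym (tuple-tuple-index l a i)) z))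
      where open Tuples Card-S k

  abstract
    -- An injective linear map from coefficient vectors to themselves is surjective by counting; no
    -- determinant or elimination is involved.
    square-solve : ∀ k (M : Fin k → Fin k → K) → (∀ i → Scalars k (M i)) →
      (∀ l → Scalars k l → (∀ i → lc k l (M i) ≡ 0#) → ∀ i → l i ≡ 0#) →
      ∀ y → Scalars k y → Σ (Fin k → K) λ l → Scalars k l × (∀ i → lc k l (M i) ≡ y i)
    square-solve k M M∈ inj y y∈ with injective⇒surjective g g-inj ℕₚ.≤-refl (tuple-index y y∈)
      where
      open Tuples Card-S k
      value : ∀ j → Scalars k (λ i → lc k (tuple j) (M i))
      value j i = 𝔽-∑ s k (λ i′ → 𝔽-* s (tuple-∈ j i′) (M∈ i i′))
      g : Fin (r ℕ.^ k) → Fin (r ℕ.^ k)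
      g j = tuple-index (λ i → lc k (tuple j) (M i)) (value j)
      same : ∀ j j′ → g j ≡ g j′ → ∀ i → lc k (tuple j) (M i) ≡ lc k (tuple j′) (M i)
      same j j′ eq i = trans (sym (tuple-tuple-index _ (value j) i)) (trans (cong (λ z → tuple z i) eq) (tuple-tuple-index _ (value j′) i))
      g-inj : Injective _≡_ _≡_ g
      g-inj {j} {j′} eq = tuple-inj j j′ (λ i → x-y≡0⇒x≡y (inj (λ i → tuple j i + - tuple j′ i)
        (λ i → 𝔽-+ s (tuple-∈ j i) (𝔽-neg s (tuple-∈ j′ i)))
        (λ i → trans (sym (lc-- k _ _ (M i))) (x≡y⇒x-y≡0 (same j j′ eq i))) i))
    ... | j , eq = tuple j , tuple-∈ j , λ i → trans (sym (tuple-tuple-index _ _ i)) (trans (cong (λ z → tuple z i) eq) (tuple-tuple-index y y∈ i))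
      where open Tuples Card-S k

-- Duality under the trace form

module TraceDual (F : Field) (q n : ℕ) (pp : IsPrimePower q) (1≤n : 1 ≤ n) (ord : Over.HasOrder F q n) where
  open TraceForm F q n pp 1≤n ord public
  open LinearAlgebra F q n pp 1≤n ord 1 q Card-Fq public

  Tr-lc : ∀ k l v x → Scalars k l → Tr (lc k l v * x) ≡ lc k l (λ j → Tr (v j * x))
  Tr-lc k l v x a = trans (cong Tr (trans (*-comm _ x) (trans (lc-*ʳ k x l v) (∑-cong k (λ i → cong (l i *_) (*-comm x (v i)))))))
    (Tr-∑ k l (λ j → v j * x) a)

  -- For a basis of K the Gram matrix of the trace form has trivial kernel by nondegeneracy, so the
  -- system is solvable. A smaller independent family is first extended to a basis, prescribing 0 on
  -- the new vectors.
  trace-interpolation : ∀ k v → Indep k v → ∀ y → Scalars k y → Σ K λ ξ → ∀ i → Tr (ξ * v i) ≡ y i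
  trace-interpolation k v ind = extension-induction {U = λ _ → ⊤} (λ _ → yes tt)
    (λ k v → ∀ y → Scalars k y → Σ K λ ξ → ∀ i → Tr (ξ * v i) ≡ y i) base step k v ind (λ _ → tt)
    where
    step : ∀ k (v : Fin k → K) w → (∀ y → Scalars (suc k) y → Σ K λ ξ → ∀ i → Tr (ξ * (w ∷ v) i) ≡ y i) →
           ∀ y → Scalars k y → Σ K λ ξ → ∀ i → Tr (ξ * v i) ≡ y i
    step k v w f y a = let (ξ , eq) = f (0# ∷ y) (λ { zero → 𝔽-0 1 ; (suc i) → a i }) in ξ , eq ∘ suc

    base : ∀ k v → Indep k v → (∀ (i : Fin k) → ⊤) → (∀ x → ⊤ → InSpan k v x) →
           ∀ y → Scalars k y → Σ K λ ξ → ∀ i → Tr (ξ * v i) ≡ y i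
    base k v ind _ sp y a =
      let (l , l∈ , eq) = square-solve k (λ i j → Tr (v j * v i)) (λ i j → Tr-∈Fq _) injective y a
      in lc k l v , λ i → trans (Tr-lc k l v (v i) l∈) (eq i)
      where
      injective : ∀ l → Scalars k l → (∀ i → lc k l (λ j → Tr (v j * v i)) ≡ 0#) → ∀ i → l i ≡ 0#
      injective l l∈ eq = ind l l∈ (Tr-nondegenerate (λ x → vanish x (sp x tt)))
        where
        ξ = lc k l v
        vanish : ∀ x → InSpan k v x → Tr (ξ * x) ≡ 0#
        vanish x (m , m∈ , refl) = trans (cong Tr (*-comm ξ _)) (trans (Tr-lc k m v ξ m∈)
          (∑-0 k (λ i → trans (cong (m i *_) (trans (cong Tr (*-comm (v i) ξ)) (trans (Tr-lc k l v (v i) l∈) (eq i)))) (zeroʳ _))))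

  -- Lets polynomials in b of different formal lengths be compared. The last component says that
  -- vanishing of the padded coefficients forces vanishing of the original ones.
  pad : ∀ {k m} → k ≤ m → (l : Fin k → K) → Scalars k l → (g : ℕ → K) →
        Σ (Fin m → K) λ l̂ → Scalars m l̂ × lc k l (g ∘ toℕ) ≡ lc m l̂ (g ∘ toℕ) × ((∀ i → l̂ i ≡ 0#) → ∀ i → l i ≡ 0#)
  pad {m = m} z≤n l a g = (λ _ → 0#) , (λ _ → 𝔽-0 1) , sym (∑-0 m (λ i → zeroˡ _)) , λ _ ()
  pad (s≤s k≤m) l a g = let (l̂ , â , eq , z) = pad k≤m (l ∘ suc) (a ∘ suc) (g ∘ suc) in
    l zero ∷ l̂ , (λ { zero → a zero ; (suc i) → â i }) , cong (l zero * g 0 +_) eq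
    , λ eq₀ → λ { zero → eq₀ zero ; (suc i) → z (eq₀ ∘ suc) i }

  -- The simple extension F_q(b)

  module Powers (b : K) where
    pow : ∀ k → Fin k → K
    pow k i = b ^ toℕ i

    Indep-snoc : ∀ k → Indep k (pow k) → ¬ InSpan k (pow k) (b ^ k) → Indep (suc k) (pow (suc k))
    Indep-snoc k ind b^k∉ l a eq i = last-or-init (view i)
      where
      open ≡-Reasoning
      -- `Indep-∷` adjoins at the front, whereas the new highest power stands at the end, so the
      -- coefficients are rotated.
      rotated : ∀ i → (l (fromℕ k) ∷ (l ∘ inject₁)) i ≡ 0#
      rotated = Indep-∷ k ind b^k∉ _ (λ { zero → a _ ; (suc i) → a _ }) (begin
        l (fromℕ k) * (b ^ k) + lc k (l ∘ inject₁) (pow k)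
          ≡⟨ +-comm _ _ ⟩
        lc k (l ∘ inject₁) (pow k) + l (fromℕ k) * (b ^ k)
          ≡⟨ cong₂ _+_ (∑-cong k (λ i → cong (λ m → l (inject₁ i) * (b ^ m)) (sym (Finₚ.toℕ-inject₁ i))))
                       (cong (λ m → l (fromℕ k) * (b ^ m)) (sym (Finₚ.toℕ-fromℕ k))) ⟩
        ∑ k ((λ i → l i * pow (suc k) i) ∘ inject₁) + l (fromℕ k) * pow (suc k) (fromℕ k)
          ≡⟨ sym (∑-snoc k (λ i → l i * pow (suc k) i)) ⟩
        lc (suc k) l (pow (suc k))
          ≡⟨ eq ⟩
        0# ∎)
      last-or-init : ∀ {i} → View i → l i ≡ 0#
      last-or-init ‵fromℕ       = rotated zero
      last-or-init (‵inject₁ j) = rotated (suc j)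

    abstract
      -- The first exponent whose power depends on the earlier ones: t is the degree of the minimal
      -- polynomial of b.
      minimal-relation : ∃ λ t → Indep t (pow t) × InSpan t (pow t) (b ^ t)
      minimal-relation = go (q ℕ.^ n) 0 ℕₚ.≤-refl (λ _ _ _ ())
        where
        go : ∀ fuel k → q ℕ.^ n ≤ k ℕ.+ fuel → Indep k (pow k) → ∃ λ t → Indep t (pow t) × InSpan t (pow t) (b ^ t)
        go zero k le ind = contradiction
          (ℕₚ.≤-trans (n<q^n 2≤r k) (ℕₚ.≤-trans (Indep⇒≤|K| k ind) (subst (q ℕ.^ n ≤_) (ℕₚ.+-identityʳ k) le))) ℕₚ.1+n≰n
        go (suc fuel) k le ind = extend (InSpan? k (pow k) (b ^ k))
          where
          extend : Dec (InSpan k (pow k) (b ^ k)) → ∃ λ t → Indep t (pow t) × InSpan t (pow t) (b ^ t)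
          extend (yes b^k∈) = k , ind , b^k∈
          extend (no b^k∉) = go fuel (suc k) (subst (q ℕ.^ n ≤_) (ℕₚ.+-suc k fuel) le) (Indep-snoc k ind b^k∉)

  module SimpleExtension (b : K) (b∉Fq : ¬ Fq b) where
    open Powers b public

    t : ℕ
    t = proj₁ minimal-relation

    pow-indep : Indep t (pow t)
    pow-indep = proj₁ (proj₂ minimal-relation)

    private
      b^t∈ : InSpan t (pow t) (b ^ t)
      b^t∈ = proj₂ (proj₂ minimal-relation)

    2≤t : 2 ≤ t
    2≤t = go t b^t∈
      where
      go : ∀ t → InSpan t (pow t) (b ^ t) → 2 ≤ t
      go 0 (l , a , eq) = contradiction (sym eq) 0≢1
      go 1 (l , a , eq) = contradiction (subst Fq (trans (sym (trans (+-identityʳ _) (*-identityʳ _))) (trans (sym eq) (*-identityʳ b))) (a zero)) b∉Fq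
      go (suc (suc t)) _ = s≤s (s≤s z≤n)

    1≤t : 1 ≤ t
    1≤t = ℕₚ.≤-trans (s≤s z≤n) 2≤t

    t≤n : t ≤ n
    t≤n = ^-cancelʳ-≤ 2≤q t n (Indep⇒≤|K| t pow-indep)

    E : K → Set
    E = InSpan t (pow t)

    E-isSubspace : Lin.IsSubspace K-VS Fq E
    E-isSubspace = InSpan-isSubspace t (pow t)

    -- Multiplication by b raises each exponent by one, and the only power leaving the range, b^t,
    -- is brought back by the minimal relation.
    E-b* : ∀ x → E x → E (b * x)
    E-b* x (l , a , refl) = subst E (sym (lc-*ʳ t b l (pow t))) (lc-∈ E-isSubspace t a (λ i → next i (ℕₚ.m≤n⇒m<n∨m≡n (Finₚ.toℕ<n i))))
      where
      next : ∀ (i : Fin t) → suc (toℕ i) < t ⊎ suc (toℕ i) ≡ t → E (b ^ suc (toℕ i))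
      next i (inj₁ lt) = subst (λ m → E (b ^ m)) (Finₚ.toℕ-fromℕ< lt) (InSpan-member t (pow t) (Fin.fromℕ< lt))
      next i (inj₂ eq) = subst (λ m → E (b ^ m)) (sym eq) b^t∈

    E-^ : ∀ k → E (b ^ k)
    E-^ zero = subst (λ m → E (b ^ m)) (Finₚ.toℕ-fromℕ< 1≤t) (InSpan-member t (pow t) (Fin.fromℕ< 1≤t))
    E-^ (suc k) = E-b* (b ^ k) (E-^ k)

    private
      E-^* : ∀ k x → E x → E ((b ^ k) * x)
      E-^* zero x Ex = subst E (sym (*-identityˡ x)) Ex
      E-^* (suc k) x Ex = subst E (sym (*-assoc b (b ^ k) x)) (E-b* _ (E-^* k x Ex))

    E-* : ∀ x y → E x → E y → E (x * y)
    E-* x y (l , a , refl) Ey = subst E (trans (sym (lc-*ʳ t y l (pow t))) (*-comm y _))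
      (lc-∈ E-isSubspace t a (λ i → subst E (*-comm (b ^ toℕ i) y) (E-^* (toℕ i) y Ey)))

    private
      Card-E : Card E (q ℕ.^ t)
      Card-E = Card-span t (pow t) pow-indep

    -- E has q^t elements, contains 0 and is closed under multiplication, which is all that `fermat`
    -- asks for.
    E⊆𝔽 : ∀ x → E x → 𝔽 t x
    E⊆𝔽 = fermat Card-E (proj₁ E-isSubspace) E-*

    -- The roots of x^(q^t) - x number at most q^t, and E already supplies that many. Thus F_q(b) is
    -- the fixed field `𝔽 t`.
    𝔽⊆E : ∀ x → 𝔽 t x → E x
    𝔽⊆E x x∈ = subst E (proj₂ (proj₂ found)) (proj₁ (proj₂ found))
      where
      found : ∃ λ y → E y × y ≡ x
      found = let (m , c) = Card-dec (𝔽 t) (𝔽? t) in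
        Card-surjective Card-E c id E⊆𝔽 (λ _ _ _ _ → id) (Card-𝔽-≤ 1≤t c) x x∈

    Card-𝔽 : Card (𝔽 t) (q ℕ.^ t)
    Card-𝔽 = record { at = at Card-E ; at-∈ = λ i → E⊆𝔽 _ (at-∈ Card-E i) ; at-inj = at-inj Card-E
                     ; index = λ x p → index Card-E x (𝔽⊆E x p) ; at-index = λ x p → at-index Card-E x (𝔽⊆E x p) }

    Degree-b : Degree b t
    Degree-b = Basis⇒HasDim t (pow t) (pow-indep , (λ i → E⊆Adjoin _ (InSpan-member t (pow t) i)) , Adjoin⊆E)
      where
      E⊆Adjoin : ∀ x → E x → Adjoin b x
      E⊆Adjoin x (l , a , eq) = let (l̂ , â , e , _) = pad t≤n l a (b ^_) in l̂ , â , trans eq e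
      Adjoin⊆E : ∀ x → Adjoin b x → E x
      Adjoin⊆E x (l , a , refl) = lc-∈ E-isSubspace n a (λ i → E-^ (toℕ i))

-- The orthogonal space of ω and ωb

module Decomposition (F : Field) (q n : ℕ) (pp : IsPrimePower q) (1≤n : 1 ≤ n) (ord : Over.HasOrder F q n)
                     (b : Field.Carrier F) (b∉Fq : ¬ Over.Fq F q n b)
                     (ω : Field.Carrier F) (ω≢0 : ω ≢ Field.0# F) where
  open TraceDual F q n pp 1≤n ord
  open SimpleExtension b b∉Fq public

  private
    module Over-𝔽t = LinearAlgebra F q n pp 1≤n ord t (q ℕ.^ t) Card-𝔽

    δ-last : ∀ k → Dec (suc k ≡ t) → K
    δ-last k (yes _) = 1#
    δ-last k (no _)  = 0#

    δ-∈Fq : ∀ k d → Fq (δ-last k d)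
    δ-∈Fq k (yes _) = 𝔽-1 1
    δ-∈Fq k (no _)  = 𝔽-0 1

    -- c is a trace-dual vector to the last member of ω, ωb, ..., ωb^(t-1). These are independent
    -- because multiplication by ω is injective.
    c-interpolates : Σ K λ c → ∀ (i : Fin t) → Tr (c * (ω * pow t i)) ≡ δ-last (toℕ i) (suc (toℕ i) ℕ.≟ t)
    c-interpolates = trace-interpolation t (λ i → ω * pow t i)
      (λ l a eq → pow-indep l a (*-cancelˡ-0 ω≢0 (trans (lc-*ʳ t ω l (pow t)) eq)))
      (λ i → δ-last (toℕ i) (suc (toℕ i) ℕ.≟ t)) (λ i → δ-∈Fq (toℕ i) (suc (toℕ i) ℕ.≟ t))

  c : K
  c = proj₁ c-interpolates

  τ : K → ℕ → K
  τ x k = Tr (x * (ω * (b ^ k)))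

  private
    τc : ∀ k → k < t → τ c k ≡ δ-last k (suc k ℕ.≟ t)
    τc k k<t = subst (λ m → τ c m ≡ δ-last m (suc m ℕ.≟ t)) (Finₚ.toℕ-fromℕ< k<t) (proj₂ c-interpolates (Fin.fromℕ< k<t))

  τc-low : ∀ k → suc k < t → τ c k ≡ 0#
  τc-low k k<t = trans (τc k (ℕₚ.<-trans (ℕₚ.n<1+n k) k<t)) (δ-low (suc k ℕ.≟ t))
    where
    δ-low : ∀ d → δ-last k d ≡ 0#
    δ-low (yes eq) = contradiction eq (ℕₚ.<⇒≢ k<t)
    δ-low (no _) = refl

  τc-last : ∀ k → suc k ≡ t → τ c k ≡ 1#
  τc-last k eq = trans (τc k (ℕₚ.≤-reflexive eq)) (δ-high (suc k ℕ.≟ t))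
    where
    δ-high : ∀ d → δ-last k d ≡ 1#
    δ-high (yes _) = refl
    δ-high (no ne) = contradiction eq ne

  S : K → Set
  S x = ∀ (i : Fin t) → τ x (toℕ i) ≡ 0#

  S? : ∀ x → Dec (S x)
  S? x = Finₚ.all? (λ i → τ x (toℕ i) ≟ 0#)

  S-intro : ∀ x → (∀ k → k < t → τ x k ≡ 0#) → S x
  S-intro x eq i = eq (toℕ i) (Finₚ.toℕ<n i)

  S-E : ∀ x → S x → ∀ e → E e → Tr (x * (ω * e)) ≡ 0#
  S-E x Sx e (l , a , refl) = begin
    Tr (x * (ω * lc t l (pow t)))               ≡⟨ cong Tr (solve 3 (λ x w y → x :* (w :* y) := y :* (x :* w)) refl x ω (lc t l (pow t))) ⟩
    Tr (lc t l (pow t) * (x * ω))               ≡⟨ Tr-lc t l (pow t) (x * ω) a ⟩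
    lc t l (λ j → Tr (pow t j * (x * ω)))       ≡⟨ ∑-0 t (λ j → trans (cong (l j *_) (trans (cong Tr (solve 3 (λ x w y → y :* (x :* w) := x :* (w :* y)) refl x ω (pow t j))) (Sx j))) (zeroʳ (l j))) ⟩
    0#                                          ∎
    where open ≡-Reasoning

  S-+ : ∀ x y → S x → S y → S (x + y)
  S-+ x y Sx Sy i = trans (cong Tr (distribʳ _ x y)) (trans (Tr-+ _ _) (trans (cong₂ _+_ (Sx i) (Sy i)) (+-identityˡ 0#)))

  -- The factor e moves across the trace form onto ωE, which E maps into itself.
  S-𝔽* : ∀ e x → 𝔽 t e → S x → S (e * x)
  S-𝔽* e x e∈ Sx i = trans (cong Tr (solve 4 (λ e x w y → e :* x :* (w :* y) := x :* (w :* (e :* y))) refl e x ω (pow t i)))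
    (S-E x Sx (e * pow t i) (E-* e (pow t i) (𝔽⊆E e e∈) (InSpan-member t (pow t) i)))

  S-isSubspace : Lin.IsSubspace K-VS (𝔽 t) S
  S-isSubspace = (λ i → trans (cong Tr (zeroˡ _)) Tr-0) , S-+ , S-𝔽*

  c∉S : ¬ S c
  c∉S Sc = 0≢1 (trans (sym (S-E c Sc (b ^ ℕ.pred t) (E-^ (ℕ.pred t)))) (τc-last (ℕ.pred t) (ℕₚ.suc-pred t {{ℕ.>-nonZero 1≤t}})))

  c≢0 : c ≢ 0#
  c≢0 c≡0 = c∉S (subst S (sym c≡0) (proj₁ S-isSubspace))

  -- Otherwise multiplying by the inverse of e, which lies in the field E, would put c into `S`.
  -- Hence cE meets `S` only in 0.
  ce∈S⇒e≡0 : ∀ e → E e → S (c * e) → e ≡ 0#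
  ce∈S⇒e≡0 e Ee Sce = decidable-stable (e ≟ 0#) (λ e≢0 → c∉S (subst S (e⁻¹ce≡c e≢0)
    (S-𝔽* (e ⁻¹) (c * e) (𝔽-⁻¹ t e≢0 (E⊆𝔽 e Ee)) Sce)))
    where
    e⁻¹ce≡c : e ≢ 0# → (e ⁻¹) * (c * e) ≡ c
    e⁻¹ce≡c e≢0 = trans (solve 3 (λ m c e → m :* (c :* e) := e :* m :* c) refl (e ⁻¹) c e) (trans (cong (_* c) (⁻¹-inverse e e≢0)) (*-identityˡ c))

  τ-c-lc : ∀ k l m → Scalars k l → τ (c * lc k l (pow k)) m ≡ lc k l (λ j → τ (c * (b ^ toℕ j)) m)
  τ-c-lc k l m a = trans (cong (λ z → Tr (z * (ω * (b ^ m)))) (lc-*ʳ k c l (pow k))) (Tr-lc k l (λ j → c * pow k j) (ω * (b ^ m)) a)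

  private
    τ-cb^ : ∀ j m → τ (c * (b ^ j)) m ≡ τ c (j ℕ.+ m)
    τ-cb^ j m = cong Tr (trans (solve 4 (λ c x w y → c :* x :* (w :* y) := c :* (w :* (x :* y))) refl c (b ^ j) ω (b ^ m))
      (cong (λ z → c * (ω * z)) (sym (^-+ b j m))))

    τ-- : ∀ x y k → τ (x + - y) k ≡ τ x k + - τ y k
    τ-- x y k = trans (cong Tr (solve 3 (λ x y z → (x :+ :- y) :* z := x :* z :+ :- (y :* z)) refl x y (ω * (b ^ k))))
      (trans (Tr-+ _ _) (cong (τ x k +_) (Tr-neg _)))

  -- Choose e so that ce has the same traces against ω, ωb, ..., ωb^(t-1) as x. This is a square
  -- system in the t coefficients of e, and its kernel is trivial because cE meets `S` only in 0.
  K≡S+cE : ∀ x → Σ K λ e → E e × S (x + - (c * e))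
  K≡S+cE x = let (l , a , eq) = square-solve t (λ i j → τ (c * (b ^ toℕ j)) (toℕ i)) (λ i j → Tr-∈Fq _) injective
                                  (λ i → τ x (toℕ i)) (λ i → Tr-∈Fq _)
    in lc t l (pow t) , (l , a , refl) , λ i → trans (τ-- x _ (toℕ i)) (x≡y⇒x-y≡0 (sym (trans (τ-c-lc t l (toℕ i) a) (eq i))))
    where
    injective : ∀ l → Scalars t l → (∀ i → lc t l (λ j → τ (c * (b ^ toℕ j)) (toℕ i)) ≡ 0#) → ∀ i → l i ≡ 0#
    injective l a eq = pow-indep l a (ce∈S⇒e≡0 _ (l , a , refl) (λ i → trans (τ-c-lc t l (toℕ i) a) (eq i)))

  private
    S-basis : ∃ λ d → Σ (Fin d → K) λ u → Over-𝔽t.Basis S d u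
    S-basis = Over-𝔽t.basis-exists S?

    d : ℕ
    d = proj₁ S-basis

    u : Fin d → K
    u = proj₁ (proj₂ S-basis)

    u-basis : Over-𝔽t.Basis S d u
    u-basis = proj₂ (proj₂ S-basis)

    c∷u-indep : Over-𝔽t.Indep (suc d) (c ∷ u)
    c∷u-indep = Over-𝔽t.Indep-∷ d (proj₁ u-basis)
      (λ c∈ → c∉S (Over-𝔽t.InSpan-⊆ S-isSubspace d (proj₁ (proj₂ u-basis)) c c∈))

    c∷u-spans : ∀ x → Over-𝔽t.InSpan (suc d) (c ∷ u) x
    c∷u-spans x = let (e , Ee , Ss) = K≡S+cE x
                      (l , a , eq) = proj₂ (proj₂ u-basis) _ Ss
      in e ∷ l , (λ { zero → E⊆𝔽 e Ee ; (suc i) → a i })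
        , trans (solve 3 (λ x c e → x := e :* c :+ (x :+ :- (c :* e))) refl x c e) (cong (e * c +_) eq)

    Card-K′ : Card {K} (λ _ → ⊤) ((q ℕ.^ t) ℕ.^ suc d)
    Card-K′ = Over-𝔽t.Basis⇒Card (tt , (λ _ _ _ _ → tt) , (λ _ _ _ _ → tt)) (suc d) (c ∷ u)
      (c∷u-indep , (λ _ → tt) , (λ x _ → c∷u-spans x))

  m : ℕ
  m = suc d

  -- c followed by an E-basis of `S` is an E-basis of K, so q^n = (q^t)^(d+1). The quotient n/t is
  -- therefore d + 1, one more than the dimension of `S`.
  n≡m*t : n ≡ m *ℕ t
  n≡m*t = trans (^-injectiveʳ 2≤q n (t *ℕ m) (trans
    (ℕₚ.≤-antisym (Card-≤ Card-K Card-K′ id (λ _ _ → tt) (λ _ _ _ _ → id)) (Card-≤K Card-K′))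
    (ℕₚ.^-*-assoc q t m))) (ℕₚ.*-comm t m)

  S-HasDim : Lin.HasDim K-VS (𝔽 t) S (m ∸ 1)
  S-HasDim = Over-𝔽t.Basis⇒HasDim d u u-basis

  private
    t′ : ℕ
    t′ = t ∸ 2

    2+t′≡t : 2 ℕ.+ t′ ≡ t
    2+t′≡t = ℕₚ.m+[n∸m]≡n 2≤t

    -- With exponents j ≤ t - 3 and k ≤ 1, the sum j + k is at most t - 2, the range where the
    -- traces of c vanish.
    low : ∀ l → Scalars t′ l → ∀ k → k < 2 → τ (c * lc t′ l (pow t′)) k ≡ 0#
    low l a k k<2 = trans (τ-c-lc t′ l k a) (∑-0 t′ (λ j → trans (cong (l j *_)
      (trans (τ-cb^ (toℕ j) k) (τc-low (toℕ j ℕ.+ k) (bound j)))) (zeroʳ (l j))))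
      where
      open ℕₚ.≤-Reasoning
      bound : ∀ (j : Fin t′) → suc (toℕ j ℕ.+ k) < t
      bound j = begin-strict
        suc (toℕ j ℕ.+ k) ≤⟨ ℕₚ.+-monoˡ-≤ k (Finₚ.toℕ<n j) ⟩
        t′ ℕ.+ k          <⟨ ℕₚ.+-monoʳ-< t′ k<2 ⟩
        t′ ℕ.+ 2          ≡⟨ ℕₚ.+-comm t′ 2 ⟩
        2 ℕ.+ t′          ≡⟨ 2+t′≡t ⟩
        t                 ∎

    high⇒S : ∀ x → τ x 0 ≡ 0# → τ x 1 ≡ 0# → (∀ (i : Fin t′) → τ x (2 ℕ.+ toℕ i) ≡ 0#) → S x
    high⇒S x eq₀ eq₁ eq₂ = S-intro x λ where
      0 _ → eq₀
      1 _ → eq₁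
      (suc (suc k)) k<t → let k<t′ = ℕₚ.+-cancelˡ-< 2 k t′ (subst (suc (suc k) <_) (sym 2+t′≡t) k<t) in
        subst (λ i → τ x (2 ℕ.+ i) ≡ 0#) (Finₚ.toℕ-fromℕ< k<t′) (eq₂ (Fin.fromℕ< k<t′))

    E-lc : ∀ l → Scalars t′ l → E (lc t′ l (pow t′))
    E-lc l a = lc-∈ E-isSubspace t′ a (λ i → E-^ (toℕ i))

    t′≤t : t′ ≤ t
    t′≤t = ℕₚ.m∸n≤m t 2

  H : K → Set
  H x = τ x 0 ≡ 0# × τ x 1 ≡ 0#

  -- For x in `H`, the summand y is chosen to match x in the traces 2, ..., t - 1. In the traces 0
  -- and 1 both vanish, so x - y lies in `S`.
  H-decomposition : DirectSum H S (CPow c b t)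
  H-decomposition = split , join , meet
    where
    -- A kernel vector has zero traces in positions 2, ..., t - 1 by assumption and in positions 0
    -- and 1 by `low`, so it gives an element of cE in `S`. For t = 2 the system is empty.
    injective : ∀ l → Scalars t′ l → (∀ (i : Fin t′) → lc t′ l (λ j → τ (c * (b ^ toℕ j)) (2 ℕ.+ toℕ i)) ≡ 0#) → ∀ i → l i ≡ 0#
    injective l a eq =
      let (l̂ , â , e , l≡0) = pad t′≤t l a (b ^_)
          ce∈S = high⇒S _ (low l a 0 (s≤s z≤n)) (low l a 1 (s≤s (s≤s z≤n))) (λ i → trans (τ-c-lc t′ l (2 ℕ.+ toℕ i) a) (eq i))
      in l≡0 (pow-indep l̂ â (trans (sym e) (ce∈S⇒e≡0 _ (E-lc l a) ce∈S)))

    split : ∀ x → H x → Σ K λ s → Σ K λ y → S s × CPow c b t y × x ≡ s + y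
    split x (eq₀ , eq₁) =
      let (l , a , eq) = square-solve t′ (λ i j → τ (c * (b ^ toℕ j)) (2 ℕ.+ toℕ i)) (λ i j → Tr-∈Fq _) injective
                           (λ i → τ x (2 ℕ.+ toℕ i)) (λ i → Tr-∈Fq _)
          y = c * lc t′ l (pow t′)
          agree : ∀ k → τ x k ≡ τ y k → τ (x + - y) k ≡ 0#
          agree k e = trans (τ-- x y k) (x≡y⇒x-y≡0 e)
      in x + - y , y
        , high⇒S (x + - y) (agree 0 (trans eq₀ (sym (low l a 0 (s≤s z≤n))))) (agree 1 (trans eq₁ (sym (low l a 1 (s≤s (s≤s z≤n))))))
            (λ i → agree (2 ℕ.+ toℕ i) (sym (trans (τ-c-lc t′ l (2 ℕ.+ toℕ i) a) (eq i))))
        , (l , a , refl)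
        , solve 2 (λ x y → x := x :+ :- y :+ y) refl x y

    join : ∀ s y → S s → CPow c b t y → H (s + y)
    join s y Ss (l , a , refl) = at-k 0 (s≤s z≤n) , at-k 1 (s≤s (s≤s z≤n))
      where
      at-k : ∀ k → k < 2 → τ (s + c * lc t′ l (pow t′)) k ≡ 0#
      at-k k k<2 = trans (cong Tr (distribʳ _ s _)) (trans (Tr-+ _ _)
        (trans (cong₂ _+_ (S-E s Ss (b ^ k) (E-^ k)) (low l a k k<2)) (+-identityˡ 0#)))

    meet : ∀ x → S x → CPow c b t x → x ≡ 0#
    meet x Sx (l , a , refl) = trans (cong (c *_) (ce∈S⇒e≡0 _ (E-lc l a) Sx)) (zeroʳ c)

-- Coordinates on K² and a point outside the linear set

module Clubs (F : Field) (q n : ℕ) (pp : IsPrimePower q) (1≤n : 1 ≤ n) (ord : Over.HasOrder F q n) where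
  open TraceDual F q n pp 1≤n ord
  open Lin K²-VS Fq using () renaming (IsSubspace to IsSubspace²; comb to comb²)

  comb²≡ : ∀ k l w → comb² k l w ≡ (lc k l (proj₁ ∘ w) , lc k l (proj₂ ∘ w))
  comb²≡ zero l w = refl
  comb²≡ (suc k) l w = cong₂ _,_ (cong (l zero * proj₁ (w zero) +_) (cong proj₁ (comb²≡ k (l ∘ suc) (w ∘ suc))))
                                 (cong (l zero * proj₂ (w zero) +_) (cong proj₂ (comb²≡ k (l ∘ suc) (w ∘ suc))))

  comb²-∈ : ∀ {W} → IsSubspace² W → ∀ k {l} {w} → Scalars k l → (∀ i → W (w i)) → W (comb² k l w)
  comb²-∈ sub zero a w∈ = proj₁ sub
  comb²-∈ sub (suc k) a w∈ = proj₁ (proj₂ sub) _ _ (proj₂ (proj₂ sub) _ _ (a zero) (w∈ zero)) (comb²-∈ sub k (a ∘ suc) (w∈ ∘ suc))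

  functional : K → K → K² → K
  functional A B (u₁ , u₂) = A * u₁ + B * u₂

  functional-comb² : ∀ A B k l w → functional A B (comb² k l w) ≡ lc k l (functional A B ∘ w)
  functional-comb² A B k l w = begin
    functional A B (comb² k l w)                                              ≡⟨ cong (functional A B) (comb²≡ k l w) ⟩
    A * lc k l (proj₁ ∘ w) + B * lc k l (proj₂ ∘ w)                           ≡⟨ cong₂ _+_ (lc-*ʳ k A l (proj₁ ∘ w)) (lc-*ʳ k B l (proj₂ ∘ w)) ⟩
    lc k l (λ i → A * proj₁ (w i)) + lc k l (λ i → B * proj₂ (w i))           ≡⟨ sym (∑-+ k _ _) ⟩
    ∑ k (λ i → l i * (A * proj₁ (w i)) + l i * (B * proj₂ (w i)))             ≡⟨ ∑-cong k (λ i → sym (distribˡ (l i) _ _)) ⟩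
    lc k l (functional A B ∘ w)                                               ∎
    where open ≡-Reasoning

  functional-0 : ∀ A B → functional A B 0² ≡ 0#
  functional-0 A B = solve 2 (λ a b → a :* con ℤ.0ℤ :+ b :* con ℤ.0ℤ := con ℤ.0ℤ) refl A B

  functional-· : ∀ A B μ u → functional A B (μ ·² u) ≡ μ * functional A B u
  functional-· A B μ (u₁ , u₂) = solve 5 (λ a b m x y → a :* (m :* x) :+ b :* (m :* y) := m :* (a :* x :+ b :* y)) refl A B μ u₁ u₂

  -- Coordinates of K² in which ⟨v⟩ is the point ⟨(1,0)⟩.
  module Coordinates (v₁ v₂ A B : K) (det≡1 : A * v₁ + B * v₂ ≡ 1#) where
    X Y : K² → K
    X = functional A B
    Y = functional (- v₂) v₁

    v : K²
    v = v₁ , v₂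

    Y-v : Y v ≡ 0#
    Y-v = solve 2 (λ x y → (:- y) :* x :+ x :* y := con ℤ.0ℤ) refl v₁ v₂

    -- Inverse of u ↦ (X u, Y u): that map has determinant A v₁ + B v₂ = 1, so its inverse is the
    -- adjugate.
    point : K → K → K²
    point x y = (v₁ * x + - B * y) , (v₂ * x + A * y)

    point-XY : ∀ u → point (X u) (Y u) ≡ u
    point-XY (u₁ , u₂) = cong₂ _,_
      (trans (solve 6 (λ a b x y u w → x :* (a :* u :+ b :* w) :+ (:- b) :* ((:- y) :* u :+ x :* w) := (a :* x :+ b :* y) :* u) refl A B v₁ v₂ u₁ u₂)
        (trans (cong (_* u₁) det≡1) (*-identityˡ u₁)))
      (trans (solve 6 (λ a b x y u w → y :* (a :* u :+ b :* w) :+ a :* ((:- y) :* u :+ x :* w) := (a :* x :+ b :* y) :* w) refl A B v₁ v₂ u₁ u₂)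
        (trans (cong (_* u₂) det≡1) (*-identityˡ u₂)))

    X-point : ∀ x y → X (point x y) ≡ x
    X-point x y = trans (solve 6 (λ a b v w x y → a :* (v :* x :+ (:- b) :* y) :+ b :* (w :* x :+ a :* y) := (a :* v :+ b :* w) :* x) refl A B v₁ v₂ x y)
      (trans (cong (_* x) det≡1) (*-identityˡ x))

    Y-point : ∀ x y → Y (point x y) ≡ y
    Y-point x y = trans (solve 6 (λ a b v w x y → (:- w) :* (v :* x :+ (:- b) :* y) :+ v :* (w :* x :+ a :* y) := (a :* v :+ b :* w) :* y) refl A B v₁ v₂ x y)
      (trans (cong (_* y) det≡1) (*-identityˡ y))

    XY-injective : ∀ {u u′} → X u ≡ X u′ → Y u ≡ Y u′ → u ≡ u′
    XY-injective {u} {u′} eqX eqY = trans (sym (point-XY u)) (trans (cong₂ point eqX eqY) (point-XY u′))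

    Y≡0⇒Span : ∀ u → Y u ≡ 0# → u ≡ X u ·² v
    Y≡0⇒Span u eq = XY-injective (sym (trans (functional-· A B (X u) v) (trans (cong (X u *_) det≡1) (*-identityʳ _))))
      (trans eq (sym (trans (functional-· (- v₂) v₁ (X u) v) (trans (cong (X u *_) Y-v) (zeroʳ _)))))

  -- The lines Xₐ a = 0 are the points other than ⟨v⟩. Were each of them in L_W, choosing a nonzero vector of W
  -- on each would give |K| = |W| distinct vectors of W \ {0}.
  module AvoidedPoint (v₁ v₂ A B : K) (det≡1 : A * v₁ + B * v₂ ≡ 1#)
    (w : Fin n → K²) (w-indep : ∀ l → Scalars n l → comb² n l w ≡ 0² → ∀ i → l i ≡ 0#) where

    open Coordinates v₁ v₂ A B det≡1

    Xₐ : K → K² → K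
    Xₐ a = functional (A + - (a * v₂)) (B + a * v₁)

    Xₐ≡X+aY : ∀ a u → Xₐ a u ≡ X u + a * Y u
    Xₐ≡X+aY a (u₁ , u₂) = solve 7 (λ A B a v w x y → (A :+ :- (a :* w)) :* x :+ (B :+ a :* v) :* y := (A :* x :+ B :* y) :+ a :* ((:- w) :* x :+ v :* y)) refl A B a v₁ v₂ u₁ u₂

    -- Adding a multiple of `Y`, which vanishes at v, does not change the value 1 there. Hence any
    -- `Xₐ a` can replace `X` as first coordinate.
    detₐ≡1 : ∀ a → (A + - (a * v₂)) * v₁ + (B + a * v₁) * v₂ ≡ 1#
    detₐ≡1 a = trans (solve 5 (λ A B a v w → (A :+ :- (a :* w)) :* v :+ (B :+ a :* v) :* w := A :* v :+ B :* w) refl A B a v₁ v₂) det≡1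

    abstract
      -- Independence of the values on a basis of W means that the line `Xₐ a` = 0 meets W only in
      -- 0. This first coordinate then maps W bijectively to K, which makes W a graph.
      avoided : ∃ λ a → Indep n (Xₐ a ∘ w)
      avoided = decide (any? (λ a → indep? a))
        where
        toDec : ∀ {a} → Indep n (Xₐ a ∘ w) ⊎ Dependent n (Xₐ a ∘ w) → Dec (Indep n (Xₐ a ∘ w))
        toDec (inj₁ ind) = yes ind
        toDec (inj₂ (l , a , eq , i , nz)) = no (λ ind → nz (ind l a eq i))

        indep? : ∀ a → Dec (Indep n (Xₐ a ∘ w))
        indep? a = toDec (indep⊎dependent n (Xₐ a ∘ w))

        module _ (dep : ∀ a → Dependent n (Xₐ a ∘ w)) where
          open Tuples Card-Fq n
          coeff : K → Fin n → K
          coeff a = proj₁ (dep a)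

          coeff∈ : ∀ a → Scalars n (coeff a)
          coeff∈ a = proj₁ (proj₂ (dep a))

          vec : K → K²
          vec a = comb² n (coeff a) w

          Xₐ-vec : ∀ a → Xₐ a (vec a) ≡ 0#
          Xₐ-vec a = trans (functional-comb² _ _ n (coeff a) w) (proj₁ (proj₂ (proj₂ (dep a))))

          vec≢0 : ∀ a → vec a ≢ 0²
          vec≢0 a eq = let (i , nz) = proj₂ (proj₂ (proj₂ (dep a))) in nz (w-indep (coeff a) (coeff∈ a) eq i)

          -- Equal coefficients give one vector lying on both X + aY = 0 and X + a′Y = 0. For a ≠ a′
          -- it would be zero.
          coeff-inj : ∀ a a′ → (∀ i → coeff a i ≡ coeff a′ i) → a ≡ a′
          coeff-inj a a′ eq = decidable-stable (a ≟ a′) λ a≢a′ → vec≢0 a (XY-injective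
            (trans (X≡0 a≢a′) (sym (functional-0 A B))) (trans (Y≡0 a≢a′) (sym (functional-0 (- v₂) v₁))))
            where
            u = vec a
            u≡ : u ≡ vec a′
            u≡ = trans (comb²≡ n (coeff a) w) (trans (cong₂ _,_ (lc-cong n (proj₁ ∘ w) eq) (lc-cong n (proj₂ ∘ w) eq)) (sym (comb²≡ n (coeff a′) w)))
            e₁ : X u + a * Y u ≡ 0#
            e₁ = trans (sym (Xₐ≡X+aY a u)) (Xₐ-vec a)
            e₂ : X u + a′ * Y u ≡ 0#
            e₂ = trans (sym (Xₐ≡X+aY a′ u)) (trans (cong (Xₐ a′) u≡) (Xₐ-vec a′))
            Y≡0 : a ≢ a′ → Y u ≡ 0#
            Y≡0 a≢a′ = *-cancelˡ-0 {a + - a′} (a≢a′ ∘ x-y≡0⇒x≡y)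
              (trans (solve 4 (λ a a′ x y → (a :+ :- a′) :* y := (x :+ a :* y) :+ :- (x :+ a′ :* y)) refl a a′ (X u) (Y u)) (x≡y⇒x-y≡0 (trans e₁ (sym e₂))))
            X≡0 : a ≢ a′ → X u ≡ 0#
            X≡0 a≢a′ = trans (sym (trans (cong (λ y → X u + a * y) (Y≡0 a≢a′)) (trans (cong (X u +_) (zeroʳ a)) (+-identityʳ _)))) e₁

          g : Fin (q ℕ.^ n) → Fin (q ℕ.^ n)
          g i = tuple-index (coeff (at Card-K i)) (coeff∈ (at Card-K i))

          tuple-index-inj : ∀ {l l′} (a : Scalars n l) (a′ : Scalars n l′) → tuple-index l a ≡ tuple-index l′ a′ → ∀ i → l i ≡ l′ i
          tuple-index-inj a a′ eq i = trans (sym (tuple-tuple-index _ a i)) (trans (cong (λ z → tuple z i) eq) (tuple-tuple-index _ a′ i))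

          impossible : ⊥
          impossible =
            -- An injection from K to the q^n coefficient vectors attains the zero vector, although
            -- every relation has a nonzero coefficient.
            let (i , eq) = injective⇒surjective g
                  (λ eq → at-inj Card-K (coeff-inj _ _ (tuple-index-inj (coeff∈ _) (coeff∈ _) eq))) ℕₚ.≤-refl
                  (tuple-index (λ _ → 0#) (λ _ → 𝔽-0 1))
                a = at Card-K i
                (j , nz) = proj₂ (proj₂ (proj₂ (dep a)))
            in nz (tuple-index-inj (coeff∈ a) (λ _ → 𝔽-0 1) eq j)

        decide : Dec (∃ λ a → Indep n (Xₐ a ∘ w)) → ∃ λ a → Indep n (Xₐ a ∘ w)
        decide (yes found) = found
        decide (no none) = ⊥-elim (impossible (λ a → fromSum (λ ind → none (a , ind)) (indep⊎dependent n (Xₐ a ∘ w))))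
          where
          fromSum : ∀ {P Q : Set} → ¬ P → P ⊎ Q → Q
          fromSum ¬p (inj₁ p) = contradiction p ¬p
          fromSum ¬p (inj₂ q) = q

-- The club as the graph of a linear map of rank two

module ClubGraph (F : Field) (q n : ℕ) (pp : IsPrimePower q) (1≤n : 1 ≤ n) (2≤n : 2 ≤ n) (ord : Over.HasOrder F q n) where
  open TraceDual F q n pp 1≤n ord
  open Clubs F q n pp 1≤n ord
  open Lin K²-VS Fq using () renaming (IsSubspace to IsSubspace²; comb to comb²)

  module AsGraph (W : K² → Set) (W-sub : IsSubspace² W) (v₁ v₂ A B : K) (det≡1 : A * v₁ + B * v₂ ≡ 1#)
    (w : Fin n → K²) (w∈ : ∀ i → W (w i))
    (w-spans : ∀ u → W u → Σ (Fin n → K) λ l → Scalars n l × u ≡ comb² n l w)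
    (x-indep : Indep n (functional A B ∘ w))
    (v-weight : HasWeight W (v₁ , v₂) (n ∸ 2))
    (weight-1 : ∀ u → u ≢ 0² → InL W u → ¬ SamePoint (v₁ , v₂) u → HasWeight W u 1) where

    open Coordinates v₁ v₂ A B det≡1

    x y : Fin n → K
    x = X ∘ w
    y = Y ∘ w

    x-spans : ∀ z → InSpan n x z
    x-spans z = Indep-full n x-indep (tt , (λ _ _ _ _ → tt) , (λ _ _ _ _ → tt)) (λ _ → tt) Card-K ℕₚ.≤-refl z tt

    f : K → K
    f z = lc n (proj₁ (x-spans z)) y

    -- `f` is built from whatever coefficients `x-spans` returns. Independence of `x` leaves only
    -- one choice, from which linearity follows.
    f-lc : ∀ l → Scalars n l → f (lc n l x) ≡ lc n l y
    f-lc l a = let (l′ , a′ , eq) = x-spans (lc n l x) in lc-cong n y (Indep-inj n x-indep a′ a (sym eq))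

    W⇒graph : ∀ u → W u → Y u ≡ f (X u)
    W⇒graph u Wu = let (l , a , eq) = w-spans u Wu in begin
      Y u                 ≡⟨ cong Y eq ⟩
      Y (comb² n l w)     ≡⟨ functional-comb² _ _ n l w ⟩
      lc n l y            ≡⟨ sym (f-lc l a) ⟩
      f (lc n l x)        ≡⟨ cong f (sym (functional-comb² A B n l w)) ⟩
      f (X (comb² n l w)) ≡⟨ cong (f ∘ X) (sym eq) ⟩
      f (X u)             ∎
      where open ≡-Reasoning

    graph⇒W : ∀ u → Y u ≡ f (X u) → W u
    graph⇒W u eqY = let (l , a , eq) = x-spans (X u) in
      subst W (XY-injective (trans (functional-comb² A B n l w) (sym eq)) (trans (functional-comb² _ _ n l w) (sym eqY)))
        (comb²-∈ W-sub n a w∈)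

    f-+ : ∀ z z′ → f (z + z′) ≡ f z + f z′
    f-+ z z′ = let (l , a , eq) = x-spans z ; (l′ , a′ , eq′) = x-spans z′ in
      trans (cong f (trans (cong₂ _+_ eq eq′) (lc-+ n l l′ x)))
        (trans (f-lc (λ i → l i + l′ i) (λ i → 𝔽-+ 1 (a i) (a′ i))) (sym (lc-+ n l l′ y)))

    f-* : ∀ {c} z → Fq c → f (c * z) ≡ c * f z
    f-* {c} z c∈ = let (l , a , eq) = x-spans z in
      trans (cong f (trans (cong (c *_) eq) (lc-* n c l x)))
        (trans (f-lc (λ i → c * l i) (λ i → 𝔽-* 1 c∈ (a i))) (sym (lc-* n c l y)))

    f-0 : f 0# ≡ 0#
    f-0 = trans (cong f (sym (zeroˡ 0#))) (trans (f-* 0# (𝔽-0 1)) (zeroˡ _))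

    Ker Im : K → Set
    Ker z = f z ≡ 0#
    Im z = ∃ λ z′ → f z′ ≡ z

    Ker-isSubspace : Lin.IsSubspace K-VS Fq Ker
    Ker-isSubspace = f-0
      , (λ z z′ e e′ → trans (f-+ z z′) (trans (cong₂ _+_ e e′) (+-identityˡ 0#)))
      , (λ c z c∈ e → trans (f-* z c∈) (trans (cong (c *_) e) (zeroʳ c)))

    Im-isSubspace : Lin.IsSubspace K-VS Fq Im
    Im-isSubspace = (0# , f-0)
      , (λ { _ _ (z , refl) (z′ , refl) → z + z′ , f-+ z z′ })
      , (λ { c _ c∈ (z , refl) → c * z , f-* z c∈ })

    -- The vectors of W on ⟨v⟩ are those with Y = 0, and X carries them bijectively to the kernel of
    -- `f`. The weight n - 2 thus becomes the dimension of the kernel.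
    Card-Ker : Card Ker (q ℕ.^ (n ∸ 2))
    Card-Ker = Basis⇒Card Ker-isSubspace (n ∸ 2) (X ∘ e) (independent , (λ i → trans (sym (W⇒graph (e i) (proj₁ (e∈ i)))) (Y-Span (e i) (proj₂ (e∈ i)))) , spanning)
      where
      e = proj₁ v-weight
      e∈ = proj₁ (proj₂ v-weight)
      Y-Span : ∀ u → Span v u → Y u ≡ 0#
      Y-Span u (μ , refl) = trans (functional-· (- v₂) v₁ μ v) (trans (cong (μ *_) Y-v) (zeroʳ μ))
      independent : Indep (n ∸ 2) (X ∘ e)
      independent l a eq = proj₁ (proj₂ (proj₂ v-weight)) l a (XY-injective
        (trans (functional-comb² A B (n ∸ 2) l e) (trans eq (sym (functional-0 A B))))
        (trans (functional-comb² _ _ (n ∸ 2) l e) (trans (∑-0 (n ∸ 2) (λ i → trans (cong (l i *_) (Y-Span (e i) (proj₂ (e∈ i)))) (zeroʳ (l i))))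
          (sym (functional-0 (- v₂) v₁)))))
      spanning : ∀ z → Ker z → InSpan (n ∸ 2) (X ∘ e) z
      spanning z fz≡0 =
        let u = point z 0#
            Yu = Y-point z 0#
            Wu = graph⇒W u (trans Yu (sym (trans (cong f (X-point z 0#)) fz≡0)))
            (l , a , eq) = proj₂ (proj₂ (proj₂ v-weight)) u (Wu , X u , Y≡0⇒Span u Yu)
        in l , a , trans (sym (X-point z 0#)) (trans (cong X eq) (functional-comb² A B (n ∸ 2) l e))

    private
      open RankNullity f f-+

      rank-2 : ∀ k → Card Im (q ℕ.^ k) → k ≡ 2
      rank-2 k c = ℕₚ.+-cancelˡ-≡ (n ∸ 2) k 2 (sym (trans (ℕₚ.m∸n+n≡m 2≤n) (^-injectiveʳ 2≤q n (n ∸ 2 ℕ.+ k)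
        (trans (ℕₚ.≤-antisym (|K|≤|ker|*|im| Card-Ker c (λ z → z , refl)) (|ker|*|im|≤|K| Card-Ker c (λ _ → id)))
               (sym (ℕₚ.^-distribˡ-+-* q (n ∸ 2) k))))))

    abstract
      Im-basis : Σ (Fin 2 → K) λ g → Basis Im 2 g
      Im-basis = let (k , g , bas) = basis-exists {Im} (λ z → any? (λ z′ → f z′ ≟ z)) in
        go k g bas (rank-2 k (Basis⇒Card Im-isSubspace k g bas))
        where
        go : ∀ k g → Basis Im k g → k ≡ 2 → Σ (Fin 2 → K) λ g → Basis Im 2 g
        go k g bas refl = g , bas

    private
      αβ : Fin 2 → K
      αβ = proj₁ Im-basis

      αβ-basis : Basis Im 2 αβ
      αβ-basis = proj₂ Im-basis

    α β : K
    α = αβ zero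
    β = αβ (suc zero)

    lc₂ : ∀ (l : Fin 2 → K) → lc 2 l αβ ≡ l zero * α + l (suc zero) * β
    lc₂ l = cong (l zero * α +_) (+-identityʳ _)

    αβ-indep : ∀ {a c} → Fq a → Fq c → a * α + c * β ≡ 0# → a ≡ 0# × c ≡ 0#
    αβ-indep {a} {c} a∈ c∈ eq = all-0 zero , all-0 (suc zero)
      where
      l : Fin 2 → K
      l zero = a
      l (suc _) = c
      all-0 = proj₁ αβ-basis l (λ { zero → a∈ ; (suc _) → c∈ }) (trans (lc₂ l) eq)

    αβ-inj : ∀ {a a′ c c′} → Fq a → Fq a′ → Fq c → Fq c′ → a * α + c * β ≡ a′ * α + c′ * β → a ≡ a′ × c ≡ c′
    αβ-inj {a} {a′} {c} {c′} a∈ a′∈ c∈ c′∈ eq =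
      let (e₁ , e₂) = αβ-indep (𝔽-+ 1 a∈ (𝔽-neg 1 a′∈)) (𝔽-+ 1 c∈ (𝔽-neg 1 c′∈))
            (trans (solve 6 (λ a a′ c c′ α β → (a :+ :- a′) :* α :+ (c :+ :- c′) :* β := (a :* α :+ c :* β) :+ :- (a′ :* α :+ c′ :* β)) refl a a′ c c′ α β)
                   (x≡y⇒x-y≡0 eq))
      in x-y≡0⇒x≡y e₁ , x-y≡0⇒x≡y e₂

    private
      abstract
        y-coords : ∀ i → InSpan 2 αβ (y i)
        y-coords i = proj₂ (proj₂ αβ-basis) (y i) (x i , trans (cong f (lc-δ i)) (trans (f-lc _ (proj₁ (proj₂ (InSpan-member n x i)))) (y-δ i)))
          where
          lc-δ : ∀ i → x i ≡ lc n (proj₁ (InSpan-member n x i)) x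
          lc-δ i = proj₂ (proj₂ (InSpan-member n x i))
          y-δ : ∀ i → lc n (proj₁ (InSpan-member n x i)) y ≡ y i
          y-δ i = trans (sym (f-lc _ (proj₁ (proj₂ (InSpan-member n x i))))) (trans (cong f (sym (lc-δ i))) (sym (W⇒graph (w i) (w∈ i))))

      abstract
        -- The coefficient of α in `f` is an F_q-linear form on K, hence given by the trace against
        -- some ξ; fixing its values on the basis `x` is enough.
        ξ-exists : Σ K λ ξ → ∀ i → Tr (ξ * x i) ≡ proj₁ (y-coords i) zero
        ξ-exists = trace-interpolation n x x-indep (λ i → proj₁ (y-coords i) zero) (λ i → proj₁ (proj₂ (y-coords i)) zero)

      abstract
        η-exists : Σ K λ η → ∀ i → Tr (η * x i) ≡ proj₁ (y-coords i) (suc zero)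
        η-exists = trace-interpolation n x x-indep (λ i → proj₁ (y-coords i) (suc zero)) (λ i → proj₁ (proj₂ (y-coords i)) (suc zero))

    ξ η : K
    ξ = proj₁ ξ-exists
    η = proj₁ η-exists

    f≡ : ∀ z → f z ≡ Tr (ξ * z) * α + Tr (η * z) * β
    f≡ z = let (l , a , eq) = x-spans z in begin
      lc n l y
        ≡⟨ ∑-cong n (λ i → cong (l i *_) (trans (proj₂ (proj₂ (y-coords i))) (trans (lc₂ (proj₁ (y-coords i)))
             (sym (cong₂ (λ u v → u * α + v * β) (proj₂ ξ-exists i) (proj₂ η-exists i)))))) ⟩
      ∑ n (λ i → l i * (Tr (ξ * x i) * α + Tr (η * x i) * β))
        ≡⟨ ∑-cong n (λ i → solve 5 (λ l u v α β → l :* (u :* α :+ v :* β) := α :* (l :* u) :+ β :* (l :* v)) refl (l i) (Tr (ξ * x i)) (Tr (η * x i)) α β) ⟩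
      ∑ n (λ i → α * (l i * Tr (ξ * x i)) + β * (l i * Tr (η * x i)))
        ≡⟨ ∑-+ n _ _ ⟩
      ∑ n (λ i → α * (l i * Tr (ξ * x i))) + ∑ n (λ i → β * (l i * Tr (η * x i)))
        ≡⟨ sym (cong₂ _+_ (∑-*ˡ n α _) (∑-*ˡ n β _)) ⟩
      α * lc n l (λ i → Tr (ξ * x i)) + β * lc n l (λ i → Tr (η * x i))
        ≡⟨ cong₂ (λ u v → α * u + β * v) (Tr-expand ξ l a eq) (Tr-expand η l a eq) ⟩
      α * Tr (ξ * z) + β * Tr (η * z)
        ≡⟨ cong₂ _+_ (*-comm _ _) (*-comm _ _) ⟩
      Tr (ξ * z) * α + Tr (η * z) * β ∎
      where
      open ≡-Reasoning
      Tr-expand : ∀ ζ l → Scalars n l → z ≡ lc n l x → lc n l (λ i → Tr (ζ * x i)) ≡ Tr (ζ * z)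
      Tr-expand ζ l a eq = trans (∑-cong n (λ i → cong (λ u → l i * Tr u) (*-comm ζ (x i))))
        (trans (sym (Tr-lc n l x ζ a)) (cong Tr (trans (*-comm _ ζ) (cong (ζ *_) (sym eq)))))

    private
      f≡⇒Tr : ∀ z {a c} → Fq a → Fq c → f z ≡ a * α + c * β → Tr (ξ * z) ≡ a × Tr (η * z) ≡ c
      f≡⇒Tr z a∈ c∈ eq = αβ-inj (Tr-∈Fq _) a∈ (Tr-∈Fq _) c∈ (trans (sym (f≡ z)) eq)

      zα = proj₁ (proj₁ (proj₂ αβ-basis) zero)
      zβ = proj₁ (proj₁ (proj₂ αβ-basis) (suc zero))

      Tr-zα : Tr (ξ * zα) ≡ 1# × Tr (η * zα) ≡ 0#
      Tr-zα = f≡⇒Tr zα (𝔽-1 1) (𝔽-0 1) (trans (proj₂ (proj₁ (proj₂ αβ-basis) zero))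
        (solve 2 (λ α β → α := con ℤ.1ℤ :* α :+ con ℤ.0ℤ :* β) refl α β))

      Tr-zβ : Tr (ξ * zβ) ≡ 0# × Tr (η * zβ) ≡ 1#
      Tr-zβ = f≡⇒Tr zβ (𝔽-0 1) (𝔽-1 1) (trans (proj₂ (proj₁ (proj₂ αβ-basis) (suc zero)))
        (solve 2 (λ α β → β := con ℤ.0ℤ :* α :+ con ℤ.1ℤ :* β) refl α β))

    Tr-combination : ∀ {a c} z → Fq a → Fq c → Tr ((a * ξ + c * η) * z) ≡ a * Tr (ξ * z) + c * Tr (η * z)
    Tr-combination {a} {c} z a∈ c∈ = trans
      (cong Tr (solve 5 (λ a c ξ η z → (a :* ξ :+ c :* η) :* z := a :* (ξ :* z) :+ c :* (η :* z)) refl a c ξ η z))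
      (trans (Tr-+ _ _) (cong₂ _+_ (Tr-* _ a∈) (Tr-* _ c∈)))

    -- `zα` and `zβ`, mapped by `f` to α and β, are trace-dual to ξ and η, so pairing a relation
    -- with them isolates its coefficients.
    ξη-indep : ∀ {a c} → Fq a → Fq c → a * ξ + c * η ≡ 0# → a ≡ 0# × c ≡ 0#
    ξη-indep {a} {c} a∈ c∈ eq =
        trans (solve 2 (λ a c → a := a :* con ℤ.1ℤ :+ c :* con ℤ.0ℤ) refl a c) (trans (sym (cong₂ (λ u v → a * u + c * v) (proj₁ Tr-zα) (proj₂ Tr-zα))) (vanish zα))
      , trans (solve 2 (λ a c → c := a :* con ℤ.0ℤ :+ c :* con ℤ.1ℤ) refl a c) (trans (sym (cong₂ (λ u v → a * u + c * v) (proj₁ Tr-zβ) (proj₂ Tr-zβ))) (vanish zβ))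
      where
      vanish : ∀ z → a * Tr (ξ * z) + c * Tr (η * z) ≡ 0#
      vanish z = trans (sym (Tr-combination z a∈ c∈)) (trans (cong (λ u → Tr (u * z)) eq) (trans (cong Tr (zeroˡ z)) Tr-0))

    ξ≢0 : ξ ≢ 0#
    ξ≢0 eq = 0≢1 (trans (sym Tr-0) (trans (cong Tr (sym (trans (cong (_* zα) eq) (zeroˡ zα)))) (proj₁ Tr-zα)))

    η≢0 : η ≢ 0#
    η≢0 eq = 0≢1 (trans (sym Tr-0) (trans (cong Tr (sym (trans (cong (_* zβ) eq) (zeroˡ zβ)))) (proj₂ Tr-zβ)))

    α≢0 : α ≢ 0#
    α≢0 eq = 0≢1 (sym (proj₁ (αβ-indep (𝔽-1 1) (𝔽-0 1) (trans (cong (λ u → 1# * u + 0# * β) eq)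
      (solve 1 (λ β → con ℤ.1ℤ :* con ℤ.0ℤ :+ con ℤ.0ℤ :* β := con ℤ.0ℤ) refl β)))))

    b : K
    b = (α ⁻¹) * β

    αb≡β : α * b ≡ β
    αb≡β = trans (sym (*-assoc _ _ _)) (trans (cong (_* β) (⁻¹-inverse α α≢0)) (*-identityˡ β))

    b∉Fq : ¬ Fq b
    b∉Fq b∈ = 0≢1 (sym (proj₂ (αβ-indep (𝔽-neg 1 b∈) (𝔽-1 1) (trans (cong (λ u → - b * α + 1# * u) (sym αb≡β))
      (solve 2 (λ α b → (:- b) :* α :+ con ℤ.1ℤ :* (α :* b) := con ℤ.0ℤ) refl α b)))))

    p : K → K
    p z = Tr (ξ * z) + b * Tr (η * z)

    f≡αp : ∀ z → f z ≡ α * p z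
    f≡αp z = trans (f≡ z) (trans (cong (λ u → Tr (ξ * z) * α + Tr (η * z) * u) (sym αb≡β))
      (solve 4 (λ r s α b → r :* α :+ s :* (α :* b) := α :* (r :+ b :* s)) refl (Tr (ξ * z)) (Tr (η * z)) α b))

    private
      α⁻¹ : K
      α⁻¹ = α ⁻¹

      -- The second row is Y divided by α, which turns the graph of f = αp into that of p.
      C′ D′ : K
      C′ = α⁻¹ * - v₂
      D′ = α⁻¹ * v₁

      act′ : K² → K²
      act′ = act A B C′ D′

      act′≡ : ∀ u → act′ u ≡ (X u , α⁻¹ * Y u)
      act′≡ (u₁ , u₂) = cong (A * u₁ + B * u₂ ,_) (solve 5 (λ a v w x y → a :* w :* x :+ a :* v :* y := a :* (w :* x :+ v :* y)) refl α⁻¹ v₁ (- v₂) u₁ u₂)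

      act′-· : ∀ μ u → act′ (μ ·² u) ≡ μ ·² act′ u
      act′-· μ u = cong₂ _,_ (functional-· A B μ u) (functional-· C′ D′ μ u)

      act′-0 : act′ 0² ≡ 0²
      act′-0 = cong₂ _,_ (functional-0 A B) (functional-0 C′ D′)

      act′-≢0 : ∀ u → u ≢ 0² → act′ u ≢ 0²
      act′-≢0 u u≢0 eq = u≢0 (XY-injective (trans (cong proj₁ eq) (sym (functional-0 A B)))
        (trans (*-cancelˡ-0 (⁻¹-≢0 α≢0) (trans (sym (cong proj₂ (act′≡ u))) (cong proj₂ eq))) (sym (functional-0 (- v₂) v₁))))

      W⇒Graph : ∀ u → W u → Graph p (act′ u)
      W⇒Graph u Wu = *-cancelˡ α≢0 (begin
        α * proj₂ (act′ u)   ≡⟨ cong (λ z → α * proj₂ z) (act′≡ u) ⟩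
        α * (α⁻¹ * Y u)      ≡⟨ sym (*-assoc _ _ _) ⟩
        α * α⁻¹ * Y u        ≡⟨ cong (_* Y u) (⁻¹-inverse α α≢0) ⟩
        1# * Y u             ≡⟨ *-identityˡ _ ⟩
        Y u                  ≡⟨ W⇒graph u Wu ⟩
        f (X u)              ≡⟨ f≡αp (X u) ⟩
        α * p (X u)          ∎)
        where open ≡-Reasoning

      Graph⇒W : ∀ u → Graph p (act′ u) → W u
      Graph⇒W u eq = graph⇒W u (begin
        Y u                  ≡⟨ sym (*-identityˡ _) ⟩
        1# * Y u             ≡⟨ cong (_* Y u) (sym (⁻¹-inverse α α≢0)) ⟩
        α * α⁻¹ * Y u        ≡⟨ *-assoc _ _ _ ⟩
        α * (α⁻¹ * Y u)      ≡⟨ cong (λ z → α * proj₂ z) (sym (act′≡ u)) ⟩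
        α * proj₂ (act′ u)   ≡⟨ cong (α *_) eq ⟩
        α * p (X u)          ≡⟨ sym (f≡αp (X u)) ⟩
        f (X u)              ∎)
        where open ≡-Reasoning

    equivalent : PGLEquiv W (Graph p)
    equivalent = A , B , C′ , D′
      , (λ eq → ⁻¹-≢0 α≢0 (trans (sym (trans (solve 5 (λ a b m v w → a :* (m :* v) :+ :- (b :* (m :* (:- w))) := m :* (a :* v :+ b :* w)) refl A B α⁻¹ v₁ v₂)
            (trans (cong (α⁻¹ *_) det≡1) (*-identityʳ _)))) eq))
      , λ u u≢0 →
          (λ { (u′ , Wu′ , u′≢0 , μ , refl) → act′ u′ , W⇒Graph u′ Wu′ , act′-≢0 u′ u′≢0 , μ , act′-· μ u })
        , (λ { (z , Gz , z≢0 , μ , eq) → μ ·² u , Graph⇒W (μ ·² u) (subst (Graph p) (trans eq (sym (act′-· μ u))) Gz)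
             , (λ μu≡0 → z≢0 (trans eq (trans (sym (act′-· μ u)) (trans (cong act′ μu≡0) act′-0)))) , μ , refl })

    -- (z, α) and b (z, α) = (bz, β) would be F_q-independent vectors of W on the same point.
    no-fixed-ratio : ∀ z → f z ≡ α → f (b * z) ≡ β → ⊥
    no-fixed-ratio z fz fbz = b∉Fq (subst Fq b≡ (𝔽-* 1 l′∈ (𝔽-⁻¹ 1 l≢0 l∈)))
      where
      u = point z α
      Xu = X-point z α
      Yu = Y-point z α
      Wu : W u
      Wu = graph⇒W u (trans Yu (sym (trans (cong f Xu) fz)))
      Wbu : W (b ·² u)
      Wbu = graph⇒W (b ·² u) (trans (functional-· _ _ b u) (trans (cong (b *_) Yu) (trans (*-comm b α) (trans αb≡β
        (sym (trans (cong f (trans (functional-· A B b u) (cong (b *_) Xu))) fbz))))))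
      u≢0 : u ≢ 0²
      u≢0 eq = α≢0 (trans (sym Yu) (trans (cong Y eq) (functional-0 _ _)))
      u-1 : u ≡ 1# ·² u
      u-1 = sym (cong₂ _,_ (*-identityˡ _) (*-identityˡ _))
      not-v : ¬ SamePoint v u
      not-v (μ , eq) = α≢0 (trans (sym Yu) (trans (cong Y eq) (trans (functional-· _ _ μ v) (trans (cong (μ *_) Y-v) (zeroʳ μ)))))
      wt : HasWeight W u 1
      wt = weight-1 u u≢0 (u , Wu , u≢0 , 1# , u-1) not-v
      -- Weight 1 makes u and bu both F_q-multiples l e and l′ e of one vector, so b = l′/l would
      -- lie in F_q.
      e = proj₁ wt zero
      coord : ∀ u′ → W u′ × Span u u′ → Σ K λ l → Fq l × Y u′ ≡ l * Y e
      coord u′ u′∈ = let (l , a , eq) = proj₂ (proj₂ (proj₂ wt)) u′ u′∈ in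
        l zero , a zero , trans (cong Y eq) (trans (functional-comb² _ _ 1 l (proj₁ wt)) (+-identityʳ _))
      cu = coord u (Wu , 1# , u-1)
      cbu = coord (b ·² u) (Wbu , b , refl)
      l = proj₁ cu
      l′ = proj₁ cbu
      l∈ : Fq l
      l∈ = proj₁ (proj₂ cu)
      l′∈ : Fq l′
      l′∈ = proj₁ (proj₂ cbu)
      lYe≡α : l * Y e ≡ α
      lYe≡α = trans (sym (proj₂ (proj₂ cu))) Yu
      l≢0 : l ≢ 0#
      l≢0 eq = α≢0 (trans (sym lYe≡α) (trans (cong (_* Y e) eq) (zeroˡ _)))
      Ye≢0 : Y e ≢ 0#
      Ye≢0 eq = α≢0 (trans (sym lYe≡α) (trans (cong (l *_) eq) (zeroʳ _)))
      bl≡l′ : b * l ≡ l′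
      bl≡l′ = *-cancelˡ Ye≢0 (begin
        Y e * (b * l)    ≡⟨ solve 3 (λ y b l → y :* (b :* l) := b :* (l :* y)) refl (Y e) b l ⟩
        b * (l * Y e)    ≡⟨ cong (b *_) (trans lYe≡α (sym Yu)) ⟩
        b * Y u          ≡⟨ sym (functional-· _ _ b u) ⟩
        Y (b ·² u)       ≡⟨ proj₂ (proj₂ cbu) ⟩
        l′ * Y e         ≡⟨ *-comm _ _ ⟩
        Y e * l′         ∎)
        where open ≡-Reasoning
      b≡ : l′ * (l ⁻¹) ≡ b
      b≡ = trans (cong (_* (l ⁻¹)) (sym bl≡l′)) (trans (*-assoc _ _ _) (trans (cong (b *_) (⁻¹-inverse l l≢0)) (*-identityʳ b)))

    -- The dependence of ξ, η, bξ, bη and the space ⟨ω, ωb⟩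

    private
      quad : Fin 4 → K
      quad = ξ ∷ η ∷ (b * ξ) ∷ (b * η) ∷ λ ()

      abstract
        quad-dependent : Dependent 4 quad
        quad-dependent = decide (indep⊎dependent 4 quad)
          where
          decide : Indep 4 quad ⊎ Dependent 4 quad → Dependent 4 quad
          decide (inj₂ dep) = dep
          decide (inj₁ ind) =
            -- The values 1, 0 against ξ, η say f(z) = α; the values 0, 1 against bξ, bη say f(bz) =
            -- β.
            let (z , eq) = trace-interpolation 4 quad ind (1# ∷ 0# ∷ 0# ∷ 1# ∷ λ ())
                  (λ { zero → 𝔽-1 1 ; (suc zero) → 𝔽-0 1 ; (suc (suc zero)) → 𝔽-0 1 ; (suc (suc (suc zero))) → 𝔽-1 1 })
                swap : ∀ ζ → Tr (ζ * z) ≡ Tr (z * ζ)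
                swap ζ = cong Tr (*-comm ζ z)
                swap-b : ∀ ζ → Tr (ζ * (b * z)) ≡ Tr (z * (b * ζ))
                swap-b ζ = cong Tr (solve 3 (λ ζ b z → ζ :* (b :* z) := z :* (b :* ζ)) refl ζ b z)
            in ⊥-elim (no-fixed-ratio z
              (trans (f≡ z) (trans (cong₂ (λ r s → r * α + s * β) (trans (swap ξ) (eq zero)) (trans (swap η) (eq (suc zero))))
                (solve 2 (λ α β → con ℤ.1ℤ :* α :+ con ℤ.0ℤ :* β := α) refl α β)))
              (trans (f≡ (b * z)) (trans (cong₂ (λ r s → r * α + s * β) (trans (swap-b ξ) (eq (suc (suc zero)))) (trans (swap-b η) (eq (suc (suc (suc zero))))))
                (solve 2 (λ α β → con ℤ.0ℤ :* α :+ con ℤ.1ℤ :* β := β) refl α β))))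

      l = proj₁ quad-dependent
      l∈ = proj₁ (proj₂ quad-dependent)

      l₀ l₁ l₂ l₃ : K
      l₀ = l zero
      l₁ = l (suc zero)
      l₂ = l (suc (suc zero))
      l₃ = l (suc (suc (suc zero)))

      l₀∈ : Fq l₀
      l₀∈ = l∈ zero
      l₁∈ : Fq l₁
      l₁∈ = l∈ (suc zero)
      l₂∈ : Fq l₂
      l₂∈ = l∈ (suc (suc zero))
      l₃∈ : Fq l₃
      l₃∈ = l∈ (suc (suc (suc zero)))

      not-all-0 : l₀ ≡ 0# → l₁ ≡ 0# → l₂ ≡ 0# → l₃ ≡ 0# → ⊥
      not-all-0 e₀ e₁ e₂ e₃ = absurd (proj₂ (proj₂ (proj₂ quad-dependent)))
        where
        absurd : (∃ λ i → l i ≢ 0#) → ⊥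
        absurd (zero , nz) = nz e₀
        absurd (suc zero , nz) = nz e₁
        absurd (suc (suc zero) , nz) = nz e₂
        absurd (suc (suc (suc zero)) , nz) = nz e₃

    -- The part of the relation that is multiplied by b. The other part then expresses ωb in terms
    -- of ξ and η as well.
    ω : K
    ω = l₂ * ξ + l₃ * η

    private
      ωb≡ : ω * b ≡ - l₀ * ξ + - l₁ * η
      ωb≡ = x-y≡0⇒x≡y (trans
        (solve 7 (λ a c d e b ξ η → (d :* ξ :+ e :* η) :* b :+ :- ((:- a) :* ξ :+ (:- c) :* η) := a :* ξ :+ (c :* η :+ (d :* (b :* ξ) :+ (e :* (b :* η) :+ con ℤ.0ℤ)))) refl l₀ l₁ l₂ l₃ b ξ η)
        (proj₁ (proj₂ (proj₂ quad-dependent))))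

    ω≢0 : ω ≢ 0#
    ω≢0 ω≡0 =
      let (e₂ , e₃) = ξη-indep l₂∈ l₃∈ ω≡0
          (e₀ , e₁) = ξη-indep (𝔽-neg 1 l₀∈) (𝔽-neg 1 l₁∈) (trans (sym ωb≡) (trans (cong (_* b) ω≡0) (zeroˡ b)))
      in not-all-0 (neg-0 e₀) (neg-0 e₁) e₂ e₃
      where
      neg-0 : ∀ {x} → - x ≡ 0# → x ≡ 0#
      neg-0 {x} eq = trans (sym (-‿involutive x)) (trans (cong -_ eq) -0#≈0#)

    private
      1b-indep : ∀ {x y} → Fq x → Fq y → x + y * b ≡ 0# → x ≡ 0# × y ≡ 0#
      1b-indep {x} {y} x∈ y∈ eq = trans (sym (trans (cong (λ y → x + y * b) y≡0) (trans (cong (x +_) (zeroˡ b)) (+-identityʳ x)))) eq , y≡0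
        where
        y≡0 : y ≡ 0#
        y≡0 = decidable-stable (y ≟ 0#) λ y≢0 → b∉Fq (subst Fq
          (trans (solve 4 (λ x y m b → (:- x) :* m := y :* m :* b :+ (:- m) :* (x :+ y :* b)) refl x y (y ⁻¹) b)
            (trans (cong₂ (λ u v → u * b + - (y ⁻¹) * v) (⁻¹-inverse y y≢0) eq)
              (solve 2 (λ b m → con ℤ.1ℤ :* b :+ m :* con ℤ.0ℤ := b) refl b (- (y ⁻¹)))))
          (𝔽-* 1 (𝔽-neg 1 x∈) (𝔽-⁻¹ 1 y≢0 y∈)))

      -- Minus the determinant of (ω, ωb) with respect to (ξ, η). `Δξ≡` and `-Δη≡` are Cramer's rule
      -- for recovering ξ and η.
      Δ : K
      Δ = l₁ * l₂ + - (l₀ * l₃)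

      Δ∈ : Fq Δ
      Δ∈ = 𝔽-+ 1 (𝔽-* 1 l₁∈ l₂∈) (𝔽-neg 1 (𝔽-* 1 l₀∈ l₃∈))

      Δξ≡ : Δ * ξ ≡ l₁ * ω + l₃ * (ω * b)
      Δξ≡ = trans (solve 6 (λ a c d e ξ η → (c :* d :+ :- (a :* e)) :* ξ := c :* (d :* ξ :+ e :* η) :+ e :* ((:- a) :* ξ :+ (:- c) :* η)) refl l₀ l₁ l₂ l₃ ξ η)
        (cong (λ u → l₁ * ω + l₃ * u) (sym ωb≡))

      -Δη≡ : - Δ * η ≡ l₀ * ω + l₂ * (ω * b)
      -Δη≡ = trans (solve 6 (λ a c d e ξ η → (:- (c :* d :+ :- (a :* e))) :* η := a :* (d :* ξ :+ e :* η) :+ d :* ((:- a) :* ξ :+ (:- c) :* η)) refl l₀ l₁ l₂ l₃ ξ η)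
        (cong (λ u → l₀ * ω + l₂ * u) (sym ωb≡))

      -- If Δ were 0, dividing the two Cramer identities by ω would give F_q-relations between 1 and
      -- b. Their coefficients are exactly the four l's, which do not all vanish.
      Δ≢0 : Δ ≢ 0#
      Δ≢0 Δ≡0 =
        let (e₁ , e₃) = 1b-indep l₁∈ l₃∈ (factor (trans (sym Δξ≡) (trans (cong (_* ξ) Δ≡0) (zeroˡ ξ))))
            (e₀ , e₂) = 1b-indep l₀∈ l₂∈ (factor (trans (sym -Δη≡) (trans (cong (λ u → - u * η) Δ≡0) (trans (cong (_* η) -0#≈0#) (zeroˡ η)))))
        in not-all-0 e₀ e₁ e₂ e₃
        where
        factor : ∀ {x y} → x * ω + y * (ω * b) ≡ 0# → x + y * b ≡ 0#
        factor {x} {y} eq = *-cancelˡ-0 ω≢0 (trans (solve 4 (λ w x y b → w :* (x :+ y :* b) := x :* w :+ y :* (w :* b)) refl ω x y b) eq)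

    Perp2⇒ : ∀ z → Perp2 ξ η z → Tr (z * ω) ≡ 0# × Tr (z * (ω * b)) ≡ 0#
    Perp2⇒ z perp = perp l₂ l₃ l₂∈ l₃∈ , trans (cong (λ u → Tr (z * u)) ωb≡) (perp (- l₀) (- l₁) (𝔽-neg 1 l₀∈) (𝔽-neg 1 l₁∈))

    Perp2⇐ : ∀ z → Tr (z * ω) ≡ 0# → Tr (z * (ω * b)) ≡ 0# → Perp2 ξ η z
    Perp2⇐ z e₀ e₁ r s r∈ s∈ = combine-0 ξ η r∈ s∈ Trξ Trη
      where
      combine-0 : ∀ a c {r s} → Fq r → Fq s → Tr (z * a) ≡ 0# → Tr (z * c) ≡ 0# → Tr (z * (r * a + s * c)) ≡ 0#
      combine-0 a c {r} {s} r∈ s∈ ea ec = trans (cong Tr (solve 5 (λ z a c r s → z :* (r :* a :+ s :* c) := r :* (z :* a) :+ s :* (z :* c)) refl z a c r s))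
        (trans (Tr-+ _ _) (trans (cong₂ _+_ (trans (Tr-* _ r∈) (cong (r *_) ea)) (trans (Tr-* _ s∈) (cong (s *_) ec)))
          (solve 2 (λ r s → r :* con ℤ.0ℤ :+ s :* con ℤ.0ℤ := con ℤ.0ℤ) refl r s)))
      scaled : ∀ {d} ζ → Fq d → d ≢ 0# → Tr (z * (d * ζ)) ≡ 0# → Tr (z * ζ) ≡ 0#
      scaled {d} ζ d∈ d≢0 eq = *-cancelˡ-0 d≢0 (trans (sym (Tr-* _ d∈))
        (trans (cong Tr (solve 3 (λ d z ζ → d :* (z :* ζ) := z :* (d :* ζ)) refl d z ζ)) eq))
      Trξ : Tr (z * ξ) ≡ 0#
      Trξ = scaled ξ Δ∈ Δ≢0 (trans (cong (λ u → Tr (z * u)) Δξ≡) (combine-0 ω (ω * b) l₁∈ l₃∈ e₀ e₁))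
      Trη : Tr (z * η) ≡ 0#
      Trη = scaled η (𝔽-neg 1 Δ∈) (λ eq → Δ≢0 (trans (sym (-‿involutive Δ)) (trans (cong -_ eq) -0#≈0#)))
        (trans (cong (λ u → Tr (z * u)) -Δη≡) (combine-0 ω (ω * b) l₀∈ l₂∈ e₀ e₁))

theorem5p4 : (q n : ℕ) → IsPrimePower q → 5 ≤ n → (F : Field) →
    let open Over F q n in
    HasOrder → (W : K² → Set) → IsClub W →
    Σ K λ b → ¬ Fq b × Σ K λ ξ → Σ K λ η → ξ ≢ 0# × η ≢ 0#
    × PGLEquiv W (Graph (λ x → Tr (ξ * x) + b * Tr (η * x)))
    × Σ ℕ λ t → Degree b t
    × Σ K λ c → c ≢ 0#
    × Σ (K → Set) λ S → Lin.IsSubspace K-VS (𝔽 t) S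
    × Σ ℕ λ m → n ≡ m *ℕ t
    × Lin.HasDim K-VS (𝔽 t) S (m ∸ 1)
    × DirectSum (Perp2 ξ η) S (CPow c b t)
theorem5p4 q n pp 5≤n F ord W (W-sub , (w , w∈ , w-indep , w-spans) , (v₁ , v₂) , v≢0 , v-weight , weight-1) =
    b , b∉Fq , ξ , η , ξ≢0 , η≢0 , equivalent
  , t , Degree-b , c , c≢0 , S , S-isSubspace , m , n≡m*t , S-HasDim
  , (λ z perp → proj₁ H-decomposition z (Perp2⇒H z perp))
  , (λ s y Ss Cy → H⇒Perp2 (s + y) (proj₁ (proj₂ H-decomposition) s y Ss Cy))
  , proj₂ (proj₂ H-decomposition)
  where
  1≤n : 1 ≤ n
  1≤n = ℕₚ.≤-trans (s≤s z≤n) 5≤n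

  2≤n : 2 ≤ n
  2≤n = ℕₚ.≤-trans (s≤s (s≤s z≤n)) 5≤n

  open TraceDual F q n pp 1≤n ord
  open Clubs F q n pp 1≤n ord
  open ClubGraph F q n pp 1≤n 2≤n ord

  dual-to-v : Σ K λ A → Σ K λ B → A * v₁ + B * v₂ ≡ 1#
  dual-to-v = go (v₁ ≟ 0#) (v₂ ≟ 0#)
    where
    go : Dec (v₁ ≡ 0#) → Dec (v₂ ≡ 0#) → Σ K λ A → Σ K λ B → A * v₁ + B * v₂ ≡ 1#
    go (no v₁≢0) _ = v₁ ⁻¹ , 0# , trans (solve 3 (λ m x y → m :* x :+ con ℤ.0ℤ :* y := x :* m) refl (v₁ ⁻¹) v₁ v₂) (⁻¹-inverse v₁ v₁≢0)
    go (yes _) (no v₂≢0) = 0# , v₂ ⁻¹ , trans (solve 3 (λ m x y → con ℤ.0ℤ :* x :+ m :* y := y :* m) refl (v₂ ⁻¹) v₁ v₂) (⁻¹-inverse v₂ v₂≢0)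
    go (yes v₁≡0) (yes v₂≡0) = contradiction (cong₂ _,_ v₁≡0 v₂≡0) v≢0

  open AvoidedPoint v₁ v₂ (proj₁ dual-to-v) (proj₁ (proj₂ dual-to-v)) (proj₂ (proj₂ dual-to-v)) w w-indep
  -- The provisional A and B are replaced by those of the avoided functional, so that its kernel, a
  -- point outside the linear set, becomes ⟨(0,1)⟩.
  open AsGraph W W-sub v₁ v₂ _ _ (detₐ≡1 (proj₁ avoided)) w w∈ w-spans (proj₂ avoided) v-weight weight-1
  open Decomposition F q n pp 1≤n ord b b∉Fq ω ω≢0

  Perp2⇒H : ∀ z → Perp2 ξ η z → H z
  Perp2⇒H z perp =
      trans (cong (λ u → Tr (z * u)) (*-identityʳ ω)) (proj₁ (Perp2⇒ z perp))
    , trans (cong (λ u → Tr (z * (ω * u))) (*-identityʳ b)) (proj₂ (Perp2⇒ z perp))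

  H⇒Perp2 : ∀ z → H z → Perp2 ξ η z
  H⇒Perp2 z (e₀ , e₁) = Perp2⇐ z
    (trans (cong (λ u → Tr (z * u)) (sym (*-identityʳ ω))) e₀)
    (trans (cong (λ u → Tr (z * (ω * u))) (sym (*-identityʳ b))) e₁)
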